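{- There exist constants $c>0$ and $\kappa>0$ such that for all integers $n\ge 2$ and $\ell$ with $1\le \ell\le n$: (i) if $\ell> c\log^5 n$, then $\varphi(n,\ell)\ge \kappa\,\frac{\ell}{n}\,\varphi(n)$; (ii) if $\ell> c\log n$, then $\varphi(n,\ell)\ge \kappa\,\frac{\ell}{\log \ell}$.
   Context: $\mathbb{Z}_m^*=\{x\in\{0,\dots,m-1\}:\gcd(x,m)=1\}$; $\varphi(m)=|\mathbb{Z}_m^*|$ is Euler's totient function and the relative totient function is $\varphi(m,k)=|\{x\in\mathbb{Z}_m^*: x\le k\}|$. Convention: $\log x$ denotes $\max(\ln x,1)$. -}

module Defs where

open import Data.Integer.Base as ℤ using (+_; +[1+_]; +0; -[1+_])
import Data.Integer.Properties as ℤ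
open import Data.List.Base using (List; length; filter; upTo)
open import Data.Nat.Base as ℕ using (ℕ; zero; suc)
open import Data.Nat.GCD using (gcd)
import Data.Nat.Properties as ℕ
open import Data.Product using (∃; _×_; _,_)
open import Data.Rational.Base
import Data.Rational.Properties as ℚ
open import Data.Rational.Solver using (module +-*-Solver)
import Data.Rational.Unnormalised.Base as ℚᵘ
import Data.Rational.Unnormalised.Properties as ℚᵘ
open import Data.Sum using (inj₁; inj₂)
open import Relation.Binary.PropositionalEquality

ℤ* : ℕ → List ℕ
ℤ* m = filter (λ x → gcd x m ℕ.≟ 1) (upTo m)

φ : ℕ → ℕ
φ m = length (ℤ* m)

φ[_,_] : ℕ → ℕ → ℕ
φ[ m , k ] = length (filter (λ x → x ℕ.≤? k) (ℤ* m))

∣-∣<-intro : ∀ {p q ε} → p < q + ε → q < p + ε → ∣ p - q ∣ < ε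
∣-∣<-intro {p} {q} {ε} p<q+ε q<p+ε with ℚ.∣p∣≡p∨∣p∣≡-p (p - q)
... | inj₁ eq = subst (_< ε) (sym eq)
      (subst (p - q <_) (solve 2 (λ q ε → q :+ ε :+ (:- q) := ε) refl q ε)
        (ℚ.+-monoˡ-< (- q) p<q+ε))
  where open +-*-Solver
... | inj₂ eq = subst (_< ε) (sym eq)
      (subst₂ _<_ (solve 2 (λ p q → q :+ (:- p) := :- (p :+ (:- q))) refl p q)
                  (solve 2 (λ p ε → p :+ ε :+ (:- p) := ε) refl p ε)
        (ℚ.+-monoˡ-< (- p) q<p+ε))
  where open +-*-Solver

p≤∣p∣ : ∀ p → p ≤ ∣ p ∣
p≤∣p∣ (mkℚ (+ n) d c)      = ℚ.≤-refl
p≤∣p∣ (mkℚ (-[1+ n ]) d c) = ℚ.≤-trans (ℚ.nonPositive⁻¹ _) (ℚ.0≤∣p∣ (mkℚ (-[1+ n ]) d c))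

∣-∣-swap : ∀ p q → ∣ p - q ∣ ≡ ∣ q - p ∣
∣-∣-swap p q = trans (sym (ℚ.∣-p∣≡∣p∣ (p - q)))
  (cong ∣_∣ (solve 2 (λ p q → :- (p :+ (:- q)) := q :+ (:- p)) refl p q))
  where open +-*-Solver

∣-∣<-elim : ∀ {p q ε} → ∣ p - q ∣ < ε → p < q + ε
∣-∣<-elim {p} {q} {ε} h =
  subst (_< q + ε) (solve 2 (λ p q → q :+ (p :+ (:- q)) := p) refl p q)
    (ℚ.+-monoʳ-< q (ℚ.≤-<-trans (p≤∣p∣ (p - q)) h))
  where open +-*-Solver

∣-∣<-elim′ : ∀ {p q ε} → ∣ p - q ∣ < ε → q < p + ε
∣-∣<-elim′ {p} {q} {ε} h = ∣-∣<-elim (subst (_< ε) (∣-∣-swap p q) h)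

⊔-< : ∀ {p q r} → p < r → q < r → p ⊔ q < r
⊔-< {p} {q} {r} p<r q<r with ℚ.⊔-sel p q
... | inj₁ eq = subst (_< r) (sym eq) p<r
... | inj₂ eq = subst (_< r) (sym eq) q<r

*-pos : ∀ {p q} → 0ℚ < p → 0ℚ < q → 0ℚ < p * q
*-pos {p} {q} 0<p 0<q =
  subst (_< p * q) (ℚ.*-zeroʳ p) (ℚ.*-monoʳ-<-pos p {{positive 0<p}} 0<q)

*-mono-≤-< : ∀ {a b c d} → 0ℚ ≤ c → a ≤ b → 0ℚ < b → c < d → a * c < b * d
*-mono-≤-< {a} {b} {c} {d} 0≤c a≤b 0<b c<d = ℚ.≤-<-trans
  (ℚ.*-monoʳ-≤-nonNeg c {{nonNegative 0≤c}} a≤b)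
  (ℚ.*-monoʳ-<-pos b {{positive 0<b}} c<d)

inverse : ∀ {p} → 0ℚ < p → ∃ λ q → 0ℚ < q × p * q ≡ 1ℚ
inverse {p} 0<p = (1/ p) , ℚ.positive⁻¹ (1/ p) {{ℚ.1/pos⇒pos p}} , ℚ.*-inverseʳ p
  where instance
    p>0 : Positive p
    p>0 = positive 0<p
    p≢0 : NonZero p
    p≢0 = ℚ.pos⇒nonZero p

record ℝ : Set where
  constructor mkℝ
  field
    seq    : ℕ → ℚ
    cauchy : ∀ ε → 0ℚ < ε →
             ∃ λ N → ∀ m n → N ℕ.≤ m → N ℕ.≤ n → ∣ seq m - seq n ∣ < ε

open ℝ public

infix  4 _<ᴿ_ _≤ᴿ_
infixl 6 _⊔ᴿ_
infixl 7 _*ᴿ_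
infixr 8 _^ᴿ_

_<ᴿ_ : ℝ → ℝ → Set
x <ᴿ y = ∃ λ ε → 0ℚ < ε × ∃ λ N → ∀ n → N ℕ.≤ n → seq x n + ε ≤ seq y n

_≤ᴿ_ : ℝ → ℝ → Set
x ≤ᴿ y = ∀ ε → 0ℚ < ε → ∃ λ N → ∀ n → N ℕ.≤ n → seq x n ≤ seq y n + ε

fromℚ : ℚ → ℝ
fromℚ q = mkℝ (λ _ → q) λ ε 0<ε → 0 , λ _ _ _ _ → ∣-∣<-intro (q<q+ε 0<ε) (q<q+ε 0<ε)
  where
  q<q+ε : ∀ {ε} → 0ℚ < ε → q < q + ε
  q<q+ε {ε} 0<ε = subst (_< q + ε) (ℚ.+-identityʳ q) (ℚ.+-monoʳ-< q 0<ε)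

fromℕ : ℕ → ℝ
fromℕ n = fromℚ (+ n / 1)

0ᴿ 1ᴿ : ℝ
0ᴿ = fromℚ 0ℚ
1ᴿ = fromℚ 1ℚ

_⊔ᴿ_ : ℝ → ℝ → ℝ
x ⊔ᴿ y = mkℝ (λ n → seq x n ⊔ seq y n) λ ε 0<ε →
  let Nx , hx = cauchy x ε 0<ε
      Ny , hy = cauchy y ε 0<ε
  in Nx ℕ.⊔ Ny , λ m n N≤m N≤n →
     let dx = hx m n (ℕ.m⊔n≤o⇒m≤o Nx Ny N≤m) (ℕ.m⊔n≤o⇒m≤o Nx Ny N≤n)
         dy = hy m n (ℕ.m⊔n≤o⇒n≤o Nx Ny N≤m) (ℕ.m⊔n≤o⇒n≤o Nx Ny N≤n)
     in estimate {seq x m} {seq y m} {seq x n} {seq y n} dx dy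
  where
  bound : ∀ {a b c d ε} → a < c + ε → b < d + ε → a ⊔ b < c ⊔ d + ε
  bound {a} {b} {c} {d} {ε} a< b< = ⊔-<
    (ℚ.<-≤-trans a< (ℚ.+-monoˡ-≤ ε (ℚ.p≤p⊔q c d)))
    (ℚ.<-≤-trans b< (ℚ.+-monoˡ-≤ ε (ℚ.p≤q⊔p c d)))

  estimate : ∀ {a b c d ε} → ∣ a - c ∣ < ε → ∣ b - d ∣ < ε → ∣ (a ⊔ b) - (c ⊔ d) ∣ < ε
  estimate {a} {b} {c} {d} ac bd = ∣-∣<-intro
    (bound {a} {b} {c} {d} (∣-∣<-elim {a} {c} ac) (∣-∣<-elim {b} {d} bd))
    (bound {c} {d} {a} {b} (∣-∣<-elim′ {a} {c} ac) (∣-∣<-elim′ {b} {d} bd))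

bounded : ∀ x → ∃ λ B → 0ℚ < B × ∃ λ N → ∀ n → N ℕ.≤ n → ∣ seq x n ∣ ≤ B
bounded x = let N , h = cauchy x 1ℚ (ℚ.positive⁻¹ 1ℚ) in
  ∣ seq x N ∣ + 1ℚ ,
  ℚ.+-mono-≤-< (ℚ.0≤∣p∣ (seq x N)) (ℚ.positive⁻¹ 1ℚ) ,
  N , λ n N≤n → ℚ.≤-trans
    (ℚ.≤-reflexive (cong ∣_∣
      (solve 2 (λ a b → a := b :+ (a :+ (:- b))) refl (seq x n) (seq x N))))
    (ℚ.≤-trans (ℚ.∣p+q∣≤∣p∣+∣q∣ (seq x N) (seq x n - seq x N))
      (ℚ.+-monoʳ-≤ ∣ seq x N ∣ (ℚ.<⇒≤ (h n N N≤n ℕ.≤-refl))))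
  where open +-*-Solver

_*ᴿ_ : ℝ → ℝ → ℝ
x *ᴿ y = mkℝ (λ n → seq x n * seq y n) λ ε 0<ε →
  let Bx , 0<Bx , Mx , bx = bounded x
      By , 0<By , My , by = bounded y
      r , 0<r , Br≡1      = inverse (ℚ.+-mono-< 0<Bx 0<By)
      Nx , hx             = cauchy x (r * ε) (*-pos 0<r 0<ε)
      Ny , hy             = cauchy y (r * ε) (*-pos 0<r 0<ε)
  in (Mx ℕ.⊔ My) ℕ.⊔ (Nx ℕ.⊔ Ny) , λ m n N≤m N≤n →
     let M≤m = ℕ.m⊔n≤o⇒m≤o (Mx ℕ.⊔ My) _ N≤m
         M≤n = ℕ.m⊔n≤o⇒m≤o (Mx ℕ.⊔ My) _ N≤n
         K≤m = ℕ.m⊔n≤o⇒n≤o (Mx ℕ.⊔ My) _ N≤m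
         K≤n = ℕ.m⊔n≤o⇒n≤o (Mx ℕ.⊔ My) _ N≤n
     in estimate {seq x m} {seq y m} {seq x n} {seq y n} {Bx} {By} {r} {ε} Br≡1 0<Bx 0<By
          (bx m (ℕ.m⊔n≤o⇒m≤o Mx My M≤m))
          (by n (ℕ.m⊔n≤o⇒n≤o Mx My M≤n))
          (hx m n (ℕ.m⊔n≤o⇒m≤o Nx Ny K≤m) (ℕ.m⊔n≤o⇒m≤o Nx Ny K≤n))
          (hy m n (ℕ.m⊔n≤o⇒n≤o Nx Ny K≤m) (ℕ.m⊔n≤o⇒n≤o Nx Ny K≤n))
  where
  open +-*-Solver
  estimate : ∀ {a b c d A D r ε} → (A + D) * r ≡ 1ℚ → 0ℚ < A → 0ℚ < D →
             ∣ a ∣ ≤ A → ∣ d ∣ ≤ D → ∣ a - c ∣ < r * ε → ∣ b - d ∣ < r * ε →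
             ∣ a * b - c * d ∣ < ε
  estimate {a} {b} {c} {d} {A} {D} {r} {ε} eq 0<A 0<D a≤A d≤D ac bd = ℚ.≤-<-trans
    (ℚ.≤-trans
      (ℚ.≤-reflexive (cong ∣_∣ (solve 4
        (λ a b c d → a :* b :+ (:- (c :* d)) :=
                     a :* (b :+ (:- d)) :+ d :* (a :+ (:- c))) refl a b c d)))
      (ℚ.≤-trans (ℚ.∣p+q∣≤∣p∣+∣q∣ (a * (b - d)) (d * (a - c)))
        (ℚ.≤-reflexive (cong₂ _+_ (ℚ.∣p*q∣≡∣p∣*∣q∣ a (b - d)) (ℚ.∣p*q∣≡∣p∣*∣q∣ d (a - c))))))
    (subst (∣ a ∣ * ∣ b - d ∣ + ∣ d ∣ * ∣ a - c ∣ <_)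
      (trans (solve 4 (λ A D r ε → A :* (r :* ε) :+ D :* (r :* ε) := (A :+ D) :* r :* ε)
                refl A D r ε)
             (trans (cong (_* ε) eq) (ℚ.*-identityˡ ε)))
      (ℚ.+-mono-< (*-mono-≤-< (ℚ.0≤∣p∣ (b - d)) a≤A 0<A bd)
                  (*-mono-≤-< (ℚ.0≤∣p∣ (a - c)) d≤D 0<D ac)))

_^ᴿ_ : ℝ → ℕ → ℝ
x ^ᴿ zero  = 1ᴿ
x ^ᴿ suc n = x *ᴿ x ^ᴿ n

-- If ε witnesses 0 < x then seq x n ⊔ ε agrees with seq x n from some
-- index on; the maximum only makes the early terms invertible.
recip : (x : ℝ) → 0ᴿ <ᴿ x → ℝ
recip x (ε , 0<ε , _) = mkℝ (λ n → inv (seq x n)) λ η 0<η →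
  let N , h = cauchy (x ⊔ᴿ fromℚ ε) ((ε * ε) * η) (*-pos (*-pos 0<ε 0<ε) 0<η)
  in N , λ m n N≤m N≤n → estimate (seq x m) (seq x n) η (h m n N≤m N≤n)
  where
  open +-*-Solver
  lo : ∀ p → 0ℚ < p ⊔ ε
  lo p = ℚ.<-≤-trans 0<ε (ℚ.p≤q⊔p p ε)

  inv : ℚ → ℚ
  inv p = (1/ (p ⊔ ε)) {{>-nonZero (lo p)}}

  inv-inverse : ∀ p → (p ⊔ ε) * inv p ≡ 1ℚ
  inv-inverse p = ℚ.*-inverseʳ (p ⊔ ε) {{>-nonZero (lo p)}}

  estimate : ∀ p q η → ∣ (p ⊔ ε) - (q ⊔ ε) ∣ < (ε * ε) * η → ∣ inv p - inv q ∣ < η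
  estimate p q η h = ℚ.*-cancelˡ-<-nonNeg (a * b) {{nonNegative (ℚ.<⇒≤ 0<ab)}}
    (ℚ.<-≤-trans (subst (_< (ε * ε) * η) (sym scaled) h)
      (ℚ.*-monoʳ-≤-nonNeg η {{nonNegative 0≤η}} ε²≤ab))
    where
    a b : ℚ
    a = p ⊔ ε
    b = q ⊔ ε
    0<ab : 0ℚ < a * b
    0<ab = *-pos (lo p) (lo q)
    ε²≤ab : ε * ε ≤ a * b
    ε²≤ab = ℚ.≤-trans
      (ℚ.*-monoʳ-≤-nonNeg ε {{nonNegative (ℚ.<⇒≤ 0<ε)}} (ℚ.p≤q⊔p p ε))
      (ℚ.*-monoˡ-≤-nonNeg a {{nonNegative (ℚ.<⇒≤ (lo p))}} (ℚ.p≤q⊔p q ε))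
    0≤η : 0ℚ ≤ η
    0≤η = ℚ.<⇒≤ (ℚ.*-cancelˡ-<-nonNeg (ε * ε) {{nonNegative (ℚ.<⇒≤ (*-pos 0<ε 0<ε))}}
      (subst (_< (ε * ε) * η) (sym (ℚ.*-zeroʳ (ε * ε))) (ℚ.≤-<-trans (ℚ.0≤∣p∣ _) h)))
    scaled : (a * b) * ∣ inv p - inv q ∣ ≡ ∣ a - b ∣
    scaled = begin
      (a * b) * ∣ inv p - inv q ∣
        ≡⟨ cong (_* ∣ inv p - inv q ∣) (sym (ℚ.0≤p⇒∣p∣≡p (ℚ.<⇒≤ 0<ab))) ⟩
      ∣ a * b ∣ * ∣ inv p - inv q ∣
        ≡⟨ sym (ℚ.∣p*q∣≡∣p∣*∣q∣ (a * b) (inv p - inv q)) ⟩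
      ∣ (a * b) * (inv p - inv q) ∣
        ≡⟨ cong ∣_∣ (solve 4 (λ a b c d → a :* b :* (c :+ (:- d)) :=
                                 b :* (a :* c) :+ (:- (a :* (b :* d)))) refl a b (inv p) (inv q)) ⟩
      ∣ b * (a * inv p) - a * (b * inv q) ∣
        ≡⟨ cong₂ (λ u v → ∣ b * u - a * v ∣) (inv-inverse p) (inv-inverse q) ⟩
      ∣ b * 1ℚ - a * 1ℚ ∣
        ≡⟨ cong₂ (λ u v → ∣ u - v ∣) (ℚ.*-identityʳ b) (ℚ.*-identityʳ a) ⟩
      ∣ b - a ∣ ≡⟨ ∣-∣-swap b a ⟩
      ∣ a - b ∣ ∎
      where open ≡-Reasoning

Σ< : ℕ → (ℕ → ℚ) → ℚ
Σ< zero    f = 0ℚ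
Σ< (suc n) f = Σ< n f + f n

-- Right-endpoint Riemann sum for ∫₁ˣ dt/t on the partition of [1,x] into
-- steps of length 1/N, where N = k + 1: the i-th summand is
-- (1/N) · 1/(1 + (i+1)/N) = 1/(N + i + 1), for 0 ≤ i < (x - 1)N.
riemannSum : ℕ → ℕ → ℚ
riemannSum x k = Σ< ((x ℕ.∸ 1) ℕ.* suc k) (λ i → + 1 / (suc k ℕ.+ suc i))

Σ<-mono : ∀ n {f g} → (∀ i → i ℕ.< n → f i ≤ g i) → Σ< n f ≤ Σ< n g
Σ<-mono zero    h = ℚ.≤-refl
Σ<-mono (suc n) h = ℚ.+-mono-≤ (Σ<-mono n (λ i i<n → h i (ℕ.m<n⇒m<1+n i<n))) (h n ℕ.≤-refl)

Σ<-+ : ∀ m n f → Σ< (m ℕ.+ n) f ≡ Σ< m f + Σ< n (λ j → f (m ℕ.+ j))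
Σ<-+ m zero    f rewrite ℕ.+-identityʳ m = sym (ℚ.+-identityʳ _)
Σ<-+ m (suc n) f rewrite ℕ.+-suc m n =
  trans (cong (_+ f (m ℕ.+ n)) (Σ<-+ m n f)) (ℚ.+-assoc (Σ< m f) (Σ< n (λ j → f (m ℕ.+ j))) (f (m ℕ.+ n)))

Σ<-* : ∀ t M f → Σ< (t ℕ.* M) f ≡ Σ< t (λ i → Σ< M (λ j → f (i ℕ.* M ℕ.+ j)))
Σ<-* zero    M f = refl
Σ<-* (suc t) M f = trans (cong (λ k → Σ< k f) (ℕ.+-comm M (t ℕ.* M)))
  (trans (Σ<-+ (t ℕ.* M) M f) (cong (_+ Σ< M (λ j → f (t ℕ.* M ℕ.+ j))) (Σ<-* t M f)))

Σ<-const : ∀ n q → Σ< n (λ _ → q) ≡ (+ n / 1) * q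
Σ<-const zero    q = sym (ℚ.*-zeroˡ q)
Σ<-const (suc n) q = begin
  Σ< n (λ _ → q) + q       ≡⟨ cong (_+ q) (Σ<-const n q) ⟩
  (+ n / 1) * q + q        ≡⟨ solve 2 (λ a q → a :* q :+ q := (a :+ con 1ℚ) :* q) refl (+ n / 1) q ⟩
  (+ n / 1 + 1ℚ) * q       ≡⟨ cong (_* q) step ⟩
  (+ suc n / 1) * q        ∎
  where
  open ≡-Reasoning
  open +-*-Solver
  step : + n / 1 + 1ℚ ≡ + suc n / 1
  step = ℚ.toℚᵘ-injective (ℚᵘ.≃-trans (ℚ.toℚᵘ-homo-+ (+ n / 1) 1ℚ)
    (ℚᵘ.≃-trans (ℚᵘ.+-congˡ (toℚᵘ 1ℚ) (ℚ.toℚᵘ-fromℚᵘ (ℚᵘ.mkℚᵘ (+ n) 0)))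
    (ℚᵘ.≃-trans (ℚᵘ.*≡* eq) (ℚᵘ.≃-sym (ℚ.toℚᵘ-fromℚᵘ (ℚᵘ.mkℚᵘ (+ suc n) 0))))))
    where
    eq : (+ n ℤ.* + 1 ℤ.+ + 1 ℤ.* + 1) ℤ.* + 1 ≡ + suc n ℤ.* + 1
    eq = cong (ℤ._* + 1) (trans (cong (ℤ._+ + 1) (ℤ.*-identityʳ (+ n))) (cong +_ (ℕ.+-comm n 1)))

1/-anti : ∀ {a b} .{{_ : ℕ.NonZero a}} .{{_ : ℕ.NonZero b}} → a ℕ.≤ b → + 1 / b ≤ + 1 / a
1/-anti {suc a} {suc b} a≤b = ℚ.toℚᵘ-cancel-≤
  (ℚᵘ.≤-respˡ-≃ (ℚᵘ.≃-sym (ℚ.toℚᵘ-fromℚᵘ (ℚᵘ.mkℚᵘ (+ 1) b)))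
  (ℚᵘ.≤-respʳ-≃ (ℚᵘ.≃-sym (ℚ.toℚᵘ-fromℚᵘ (ℚᵘ.mkℚᵘ (+ 1) a)))
    (ℚᵘ.*≤* (ℤ.*-monoˡ-≤-nonNeg (+ 1) (ℤ.+≤+ a≤b)))))

1/-scale : ∀ c l → (+ suc l / 1) * (+ 1 / (suc c ℕ.* suc l)) ≡ + 1 / suc c
1/-scale c l = ℚ.toℚᵘ-injective
  (ℚᵘ.≃-trans (ℚ.toℚᵘ-homo-* (+ suc l / 1) (+ 1 / (suc c ℕ.* suc l)))
  (ℚᵘ.≃-trans (ℚᵘ.*-cong (ℚ.toℚᵘ-fromℚᵘ (ℚᵘ.mkℚᵘ (+ suc l) 0))
                         (ℚ.toℚᵘ-fromℚᵘ (ℚᵘ.mkℚᵘ (+ 1) (l ℕ.+ c ℕ.* suc l))))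
  (ℚᵘ.≃-trans (ℚᵘ.*≡* eq) (ℚᵘ.≃-sym (ℚ.toℚᵘ-fromℚᵘ (ℚᵘ.mkℚᵘ (+ 1) c))))))
  where
  open ≡-Reasoning
  eq : (+ suc l ℤ.* + 1) ℤ.* + suc c ≡ + 1 ℤ.* + (1 ℕ.* (suc c ℕ.* suc l))
  eq = begin
    (+ suc l ℤ.* + 1) ℤ.* + suc c      ≡⟨ cong (ℤ._* + suc c) (ℤ.*-identityʳ (+ suc l)) ⟩
    + suc l ℤ.* + suc c                ≡⟨ sym (ℤ.pos-* (suc l) (suc c)) ⟩
    + (suc l ℕ.* suc c)                ≡⟨ cong +_ (ℕ.*-comm (suc l) (suc c)) ⟩
    + (suc c ℕ.* suc l)                ≡⟨ cong +_ (sym (ℕ.*-identityˡ (suc c ℕ.* suc l))) ⟩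
    + (1 ℕ.* (suc c ℕ.* suc l))        ≡⟨ sym (ℤ.*-identityˡ (+ (1 ℕ.* (suc c ℕ.* suc l)))) ⟩
    + 1 ℤ.* + (1 ℕ.* (suc c ℕ.* suc l)) ∎

0<1/ : ∀ n → 0ℚ < + 1 / suc n
0<1/ n = ℚ.positive⁻¹ (+ 1 / suc n) {{ℚ.normalize-pos 1 (suc n)}}

archimedean : ∀ ε → 0ℚ < ε → ∃ λ N → + 1 / suc N < ε
archimedean ε@(mkℚ (+[1+ n ]) d _) _ = suc d , ℚ.toℚᵘ-cancel-<
  (ℚᵘ.<-respˡ-≃ (ℚᵘ.≃-sym (ℚ.toℚᵘ-fromℚᵘ (ℚᵘ.mkℚᵘ (+ 1) (suc d))))
    (ℚᵘ.*<* (subst (ℤ._< + suc n ℤ.* + suc (suc d)) (sym (ℤ.*-identityˡ (+ suc d)))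
      (subst (+ suc d ℤ.<_) (ℤ.pos-* (suc n) (suc (suc d)))
        (ℤ.+<+ (ℕ.<-≤-trans (ℕ.n<1+n (suc d)) (ℕ.m≤m+n (suc (suc d)) (n ℕ.* suc (suc d)))))))))
archimedean (mkℚ +0 _ _)         (*<* (ℤ.+<+ ()))
archimedean (mkℚ (-[1+ _ ]) _ _) (*<* ())

module _ (k l : ℕ) where

  private
    M N : ℕ
    M = suc l
    N = suc k

    block : ℕ → ℚ
    block i = Σ< M (λ j → + 1 / (N ℕ.* M ℕ.+ suc (i ℕ.* M ℕ.+ j)))

    block-≥ : ∀ i → + 1 / (N ℕ.+ suc i) ≤ block i
    block-≥ i = subst (_≤ block i)
      (trans (Σ<-const M (+ 1 / ((N ℕ.+ suc i) ℕ.* M))) (1/-scale (k ℕ.+ suc i) l))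
      (Σ<-mono M λ j j<M → 1/-anti (begin
        N ℕ.* M ℕ.+ suc (i ℕ.* M ℕ.+ j)   ≡⟨ cong (N ℕ.* M ℕ.+_) (sym (ℕ.+-suc (i ℕ.* M) j)) ⟩
        N ℕ.* M ℕ.+ (i ℕ.* M ℕ.+ suc j)   ≤⟨ ℕ.+-monoʳ-≤ (N ℕ.* M) (ℕ.+-monoʳ-≤ (i ℕ.* M) j<M) ⟩
        N ℕ.* M ℕ.+ (i ℕ.* M ℕ.+ M)       ≡⟨ cong (N ℕ.* M ℕ.+_) (ℕ.+-comm (i ℕ.* M) M) ⟩
        N ℕ.* M ℕ.+ suc i ℕ.* M           ≡⟨ sym (ℕ.*-distribʳ-+ M N (suc i)) ⟩
        (N ℕ.+ suc i) ℕ.* M               ∎))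
      where open ℕ.≤-Reasoning

    block-≤ : ∀ i → block i ≤ + 1 / (N ℕ.+ i)
    block-≤ i = subst (block i ≤_)
      (trans (Σ<-const M (+ 1 / ((N ℕ.+ i) ℕ.* M))) (1/-scale (k ℕ.+ i) l))
      (Σ<-mono M λ j _ → 1/-anti (begin
        (N ℕ.+ i) ℕ.* M                   ≡⟨ ℕ.*-distribʳ-+ M N i ⟩
        N ℕ.* M ℕ.+ i ℕ.* M               ≤⟨ ℕ.+-monoʳ-≤ (N ℕ.* M) (ℕ.m≤n⇒m≤1+n (ℕ.m≤m+n (i ℕ.* M) j)) ⟩
        N ℕ.* M ℕ.+ suc (i ℕ.* M ℕ.+ j)   ∎))
      where open ℕ.≤-Reasoning

    telescope : ∀ t (e : ℕ → ℚ) → Σ< t e + e t ≡ Σ< t (λ i → e (suc i)) + e 0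
    telescope zero    e = refl
    telescope (suc t) e = trans (cong (_+ e (suc t)) (telescope t e))
      (solve 3 (λ a b c → a :+ b :+ c := a :+ c :+ b) refl
        (Σ< t (λ i → e (suc i))) (e 0) (e (suc t)))
      where open +-*-Solver

    blocks : ∀ x → riemannSum x (l ℕ.+ k ℕ.* M) ≡ Σ< ((x ℕ.∸ 1) ℕ.* N) block
    blocks x = trans
      (cong (λ t → Σ< t (λ i → + 1 / (N ℕ.* M ℕ.+ suc i))) (sym (ℕ.*-assoc (x ℕ.∸ 1) N M)))
      (Σ<-* ((x ℕ.∸ 1) ℕ.* N) M (λ i → + 1 / (N ℕ.* M ℕ.+ suc i)))

  refine-≥ : ∀ x → riemannSum x k ≤ riemannSum x (l ℕ.+ k ℕ.* suc l)
  refine-≥ x = ℚ.≤-trans (Σ<-mono ((x ℕ.∸ 1) ℕ.* N) (λ i _ → block-≥ i))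
    (ℚ.≤-reflexive (sym (blocks x)))

  refine-≤ : ∀ x → riemannSum x (l ℕ.+ k ℕ.* suc l) ≤ riemannSum x k + + 1 / suc k
  refine-≤ x = begin
    riemannSum x (l ℕ.+ k ℕ.* M)        ≡⟨ blocks x ⟩
    Σ< t block                          ≤⟨ Σ<-mono t (λ i _ → block-≤ i) ⟩
    Σ< t e                              ≡⟨ sym (ℚ.+-identityʳ (Σ< t e)) ⟩
    Σ< t e + 0ℚ                         ≤⟨ ℚ.+-monoʳ-≤ (Σ< t e) (ℚ.<⇒≤ (0<1/ (k ℕ.+ t))) ⟩
    Σ< t e + e t                        ≡⟨ telescope t e ⟩
    riemannSum x k + e 0                ≤⟨ ℚ.+-monoʳ-≤ (riemannSum x k) (1/-anti (ℕ.m≤m+n N 0)) ⟩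
    riemannSum x k + + 1 / suc k        ∎
    where
    open ℚ.≤-Reasoning
    t : ℕ
    t = (x ℕ.∸ 1) ℕ.* N
    e : ℕ → ℚ
    e i = + 1 / (N ℕ.+ i)

riemannSum-close : ∀ x m n → riemannSum x m ≤ riemannSum x n + + 1 / suc n
riemannSum-close x m n = ℚ.≤-trans (refine-≥ m n x)
  (subst (λ K → riemannSum x K ≤ riemannSum x n + + 1 / suc n)
    (ℕ.suc-injective (ℕ.*-comm (suc n) (suc m))) (refine-≤ n m x))

ln : (x : ℕ) .{{_ : ℕ.NonZero x}} → ℝ
ln x = mkℝ (riemannSum x) λ ε 0<ε →
  let N , h = archimedean ε 0<ε
      close : ∀ m n → N ℕ.≤ n → riemannSum x m < riemannSum x n + ε
      close m n N≤n = ℚ.≤-<-trans (riemannSum-close x m n)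
        (ℚ.+-monoʳ-< (riemannSum x n) (ℚ.≤-<-trans (1/-anti (ℕ.s≤s N≤n)) h))
  in N , λ m n N≤m N≤n → ∣-∣<-intro (close m n N≤n) (close n m N≤m)

log : (x : ℕ) .{{_ : ℕ.NonZero x}} → ℝ
log x = ln x ⊔ᴿ 1ᴿ

0<log : (x : ℕ) .{{_ : ℕ.NonZero x}} → 0ᴿ <ᴿ log x
0<log x = 1ℚ , ℚ.positive⁻¹ 1ℚ , 0 , λ n _ → ℚ.p≤q⊔p (riemannSum x n) 1ℚ

{-# OPTIONS --safe #-}

-- Exponentiating log = Λ * 1 and restricting to integers coprime to n gives
--   ∏_{k ≤ ℓ} k = ∏_{m ≤ ℓ} E(ℓ/m),
-- where E(x) is the part of lcm(1, …, x) coprime to n, so the logarithm of the right-hand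
-- side is at most φ(n,ℓ) log ℓ.  For n = 1 the identity yields Chebyshev's bound
-- lcm(1, …, 2M) ≥ 2^M.  The primes p ∣ n change lcm(1, …, x) by a factor of at most n x^√x,
-- hence log E(x) ≫ x as soon as x ≫ log n.  The single term m = 1 gives (ii).  For (i) keep
-- all m ≤ √ℓ, for which ℓ/m ≥ √ℓ ≫ log n: then φ(n,ℓ) log ℓ ≫ ℓ Σ_{m ≤ √ℓ, (m,n) = 1} 1/m,
-- and this sum is at least (φ(n)/n) Σ_{m ≤ √ℓ} 1/m ≫ (φ(n)/n) log ℓ, by adding the prime
-- factors of n one at a time.
module Submission where

open import Data.Nat.Base using (ℕ; NonZero; _≤_)
open import Data.Product using (∃; _×_; _,_; proj₁; proj₂)
open import Data.Nat.Tactic.RingSolver using (solve-∀)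
open import Relation.Binary.PropositionalEquality
open import Defs using (φ; φ[_,_]; ℝ; _<ᴿ_; _≤ᴿ_; _*ᴿ_; _^ᴿ_; 0ᴿ; fromℚ; fromℕ; recip; log; 0<log)

-- Inclusion-exclusion over the divisors of n has a rounding error for each squarefree divisor, and
-- their number can exceed every power of log n, hence ℓ. The weights 1/m avoid this: removing the
-- multiples of one more prime p costs a factor of at least 1 - 1/p with no error term, even after
-- rounding, because p ⌊X/(m p)⌋ ≤ ⌊X/m⌋. Two demands fix the cut at √ℓ. Bounding every k ≤ ℓ by ℓ
-- costs a factor log ℓ, and only a sum of 1/m over a range as long as a power of ℓ wins it back.
-- Yet dropping the primes of n costs about log n in log E(ℓ/m), so ℓ/m must stay well above log n
-- for each m that is kept. No logarithm occurs in the counting itself: all estimates compare powers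
-- of 2 in ℕ, and exponents are rounded down to integers. The real logarithm is met only at the end,
-- through the inequality ln n ≥ t/2 for 2^t ≤ n.

module CoprimeCounting where

  open import Algebra.Core using (Op₂)
  open import Algebra.Structures using (IsCommutativeMonoid)
  open import Data.List.Base using ([]; _∷_; length; filter; applyUpTo)
  open import Data.List.Relation.Unary.All using (All; []; _∷_)
  open import Data.Nat.Base hiding (ℕ; NonZero; _≤_)
  open import Data.Nat.Coprimality using (Coprime; coprime⇒gcd≡1; gcd≡1⇒coprime; coprime-divisor; coprime-+)
  import Data.Nat.Coprimality as Coprime
  open import Data.Nat.Divisibility
  open import Data.Nat.DivMod
  open import Data.Nat.GCD using (gcd)
  open import Data.Nat.ListAction using (product)
  open import Data.Nat.Primality
  open import Data.Nat.Primality.Factorisation using (factorise; PrimeFactorisation)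
  open import Data.Nat.Properties
  open import Data.Sum.Base using (inj₁; inj₂)
  open import Function.Base using (_∘_; id)
  open import Relation.Nullary using (Dec; yes; no; ¬_; contradiction)
  open import Relation.Unary using (Pred; Decidable)

  -- Sums and products over 1, …, N

  -- Sums and products need the same laws, the products for primes and integers and the sums for
  -- their exponents, so both are instances of one fold over a commutative monoid with monotone
  -- operation.
  module Range (_∙_ : Op₂ ℕ) (ε : ℕ) (isCM : IsCommutativeMonoid _≡_ _∙_ ε)
               (∙-mono : ∀ {a b c d} → a ≤ b → c ≤ d → a ∙ c ≤ b ∙ d) where

    open IsCommutativeMonoid isCM using (assoc; comm; identityˡ; identityʳ)

    fold : ℕ → (ℕ → ℕ) → ℕ
    fold zero    f = ε
    fold (suc N) f = fold N f ∙ f (suc N)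

    fold-cong : ∀ N {f g} → (∀ k → 1 ≤ k → k ≤ N → f k ≡ g k) → fold N f ≡ fold N g
    fold-cong zero    h = refl
    fold-cong (suc N) h = cong₂ _∙_ (fold-cong N λ k 1≤k k≤N → h k 1≤k (m≤n⇒m≤1+n k≤N))
                                    (h (suc N) (s≤s z≤n) ≤-refl)

    fold-mono : ∀ N {f g} → (∀ k → 1 ≤ k → k ≤ N → f k ≤ g k) → fold N f ≤ fold N g
    fold-mono zero    h = ≤-refl
    fold-mono (suc N) h = ∙-mono (fold-mono N λ k 1≤k k≤N → h k 1≤k (m≤n⇒m≤1+n k≤N))
                                 (h (suc N) (s≤s z≤n) ≤-refl)

    fold-ε : ∀ N → fold N (λ _ → ε) ≡ ε
    fold-ε zero    = refl
    fold-ε (suc N) = trans (identityʳ _) (fold-ε N)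

    private
      interchange : ∀ a b c d → (a ∙ b) ∙ (c ∙ d) ≡ (a ∙ c) ∙ (b ∙ d)
      interchange a b c d = begin
        (a ∙ b) ∙ (c ∙ d)  ≡⟨ assoc a b (c ∙ d) ⟩
        a ∙ (b ∙ (c ∙ d))  ≡⟨ cong (a ∙_) (assoc b c d) ⟨
        a ∙ ((b ∙ c) ∙ d)  ≡⟨ cong (λ x → a ∙ (x ∙ d)) (comm b c) ⟩
        a ∙ ((c ∙ b) ∙ d)  ≡⟨ cong (a ∙_) (assoc c b d) ⟩
        a ∙ (c ∙ (b ∙ d))  ≡⟨ assoc a c (b ∙ d) ⟨
        (a ∙ c) ∙ (b ∙ d)  ∎
        where open ≡-Reasoning

    fold-∙ : ∀ N f g → fold N (λ k → f k ∙ g k) ≡ fold N f ∙ fold N g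
    fold-∙ zero    f g = sym (identityʳ ε)
    fold-∙ (suc N) f g = trans (cong (_∙ (f (suc N) ∙ g (suc N))) (fold-∙ N f g))
      (interchange (fold N f) (fold N g) (f (suc N)) (g (suc N)))

    fold-swap : ∀ M N (f : ℕ → ℕ → ℕ) →
      fold M (λ i → fold N (f i)) ≡ fold N (λ j → fold M (λ i → f i j))
    fold-swap zero    N f = sym (fold-ε N)
    fold-swap (suc M) N f = trans (cong (_∙ fold N (f (suc M))) (fold-swap M N f))
      (sym (fold-∙ N (λ j → fold M (λ i → f i j)) (f (suc M))))

    fold-++ : ∀ M N f → fold (M + N) f ≡ fold M f ∙ fold N (λ i → f (M + i))
    fold-++ M zero    f rewrite +-identityʳ M = sym (identityʳ _)
    fold-++ M (suc N) f rewrite +-suc M N =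
      trans (cong (_∙ f (suc (M + N))) (fold-++ M N f)) (assoc _ _ _)

  open Range _+_ 0 +-0-isCommutativeMonoid +-mono-≤ public using () renaming
    ( fold to Σ₁; fold-cong to Σ₁-cong; fold-mono to Σ₁-mono; fold-ε to Σ₁-0
    ; fold-∙ to Σ₁-+; fold-swap to Σ₁-swap; fold-++ to Σ₁-++ )

  open Range _*_ 1 *-1-isCommutativeMonoid *-mono-≤ public using () renaming
    ( fold to Π₁; fold-cong to Π₁-cong; fold-mono to Π₁-mono; fold-ε to Π₁-1
    ; fold-∙ to Π₁-*; fold-swap to Π₁-swap; fold-++ to Π₁-++ )

  Σ₁-*ˡ : ∀ N c f → Σ₁ N (λ k → c * f k) ≡ c * Σ₁ N f
  Σ₁-*ˡ zero    c f = sym (*-zeroʳ c)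
  Σ₁-*ˡ (suc N) c f = trans (cong (_+ c * f (suc N)) (Σ₁-*ˡ N c f))
    (sym (*-distribˡ-+ c (Σ₁ N f) (f (suc N))))

  Σ₁-const : ∀ N c → Σ₁ N (λ _ → c) ≡ N * c
  Σ₁-const zero    c = refl
  Σ₁-const (suc N) c = trans (+-comm _ c) (cong (c +_) (Σ₁-const N c))

  Π₁-^ʳ : ∀ N c f → Π₁ N (λ k → c ^ f k) ≡ c ^ Σ₁ N f
  Π₁-^ʳ zero    c f = refl
  Π₁-^ʳ (suc N) c f = trans (cong (_* c ^ f (suc N)) (Π₁-^ʳ N c f))
    (sym (^-distribˡ-+-* c (Σ₁ N f) (f (suc N))))

  ^-distribʳ-* : ∀ e a b → (a * b) ^ e ≡ a ^ e * b ^ e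
  ^-distribʳ-* zero    a b = refl
  ^-distribʳ-* (suc e) a b = trans (cong (a * b *_) (^-distribʳ-* e a b)) (lemma a b (a ^ e) (b ^ e))
    where
    lemma : ∀ a b c d → a * b * (c * d) ≡ a * c * (b * d)
    lemma = solve-∀

  Π₁-^ˡ : ∀ N e f → Π₁ N f ^ e ≡ Π₁ N (λ k → f k ^ e)
  Π₁-^ˡ zero    e f = ^-zeroˡ e
  Π₁-^ˡ (suc N) e f = trans (^-distribʳ-* e (Π₁ N f) (f (suc N))) (cong (_* f (suc N) ^ e) (Π₁-^ˡ N e f))

  Π₁-extend : ∀ {M N f} → M ≤ N → (∀ k → 1 ≤ f k) → Π₁ M f ≤ Π₁ N f
  Π₁-extend {M} {N} {f} M≤N h = begin
    Π₁ M f                                    ≡⟨ *-identityʳ _ ⟨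
    Π₁ M f * 1                                ≡⟨ cong (Π₁ M f *_) (Π₁-1 (N ∸ M)) ⟨
    Π₁ M f * Π₁ (N ∸ M) (λ _ → 1)             ≤⟨ *-monoʳ-≤ (Π₁ M f) (Π₁-mono (N ∸ M) λ k _ _ → h (M + k)) ⟩
    Π₁ M f * Π₁ (N ∸ M) (λ k → f (M + k))     ≡⟨ Π₁-++ M (N ∸ M) f ⟨
    Π₁ (M + (N ∸ M)) f                        ≡⟨ cong (λ n → Π₁ n f) (m+[n∸m]≡n M≤N) ⟩
    Π₁ N f                                    ∎
    where open ≤-Reasoning

  1≤Π₁ : ∀ N {f} → (∀ k → 1 ≤ f k) → 1 ≤ Π₁ N f
  1≤Π₁ N h = Π₁-extend {0} {N} z≤n h

  -- The Iverson bracket, with values in ℕ so that it can serve as a factor of a sum and as an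
  -- exponent in a product.
  ⟦_⟧ : ∀ {p} {P : Set p} → Dec P → ℕ
  ⟦ yes _ ⟧ = 1
  ⟦ no  _ ⟧ = 0

  module _ {p} {P : Set p} where

    ⟦⟧≤1 : (d : Dec P) → ⟦ d ⟧ ≤ 1
    ⟦⟧≤1 (yes _) = ≤-refl
    ⟦⟧≤1 (no  _) = z≤n

    ⟦⟧-yes : (d : Dec P) → P → ⟦ d ⟧ ≡ 1
    ⟦⟧-yes (yes _) _ = refl
    ⟦⟧-yes (no ¬p) p = contradiction p ¬p

    ⟦⟧-no : (d : Dec P) → ¬ P → ⟦ d ⟧ ≡ 0
    ⟦⟧-no (yes p) ¬p = contradiction p ¬p
    ⟦⟧-no (no  _) _  = refl

  ⟦⟧-mono : ∀ {p q} {P : Set p} {Q : Set q} (d : Dec P) (e : Dec Q) → (P → Q) → ⟦ d ⟧ ≤ ⟦ e ⟧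
  ⟦⟧-mono (yes p) e h = ≤-reflexive (sym (⟦⟧-yes e (h p)))
  ⟦⟧-mono (no _)  e h = z≤n

  ⟦⟧-cong : ∀ {p q} {P : Set p} {Q : Set q} (d : Dec P) (e : Dec Q) →
            (P → Q) → (Q → P) → ⟦ d ⟧ ≡ ⟦ e ⟧
  ⟦⟧-cong d e f g = ≤-antisym (⟦⟧-mono d e f) (⟦⟧-mono e d g)

  Σ₁-indicator : ∀ N (f : ℕ → ℕ) c → 1 ≤ c → Σ₁ N (λ k → f k * ⟦ k ≟ c ⟧) ≡ f c * ⟦ c ≤? N ⟧
  Σ₁-indicator zero    f c 1≤c = sym (trans (cong (f c *_) (⟦⟧-no (c ≤? 0) (<⇒≱ 1≤c))) (*-zeroʳ (f c)))
  Σ₁-indicator (suc N) f c 1≤c with suc N ≟ c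
  ... | yes refl = begin
    Σ₁ N (λ k → f k * ⟦ k ≟ suc N ⟧) + f (suc N) * 1
      ≡⟨ cong (_+ f (suc N) * 1) (Σ₁-indicator N f (suc N) 1≤c) ⟩
    f (suc N) * ⟦ suc N ≤? N ⟧ + f (suc N) * 1
      ≡⟨ cong (λ x → f (suc N) * x + f (suc N) * 1) (⟦⟧-no (suc N ≤? N) (<⇒≱ ≤-refl)) ⟩
    f (suc N) * 0 + f (suc N) * 1
      ≡⟨ cong (_+ f (suc N) * 1) (*-zeroʳ (f (suc N))) ⟩
    f (suc N) * 1
      ≡⟨ cong (f (suc N) *_) (⟦⟧-yes (suc N ≤? suc N) ≤-refl) ⟨
    f (suc N) * ⟦ suc N ≤? suc N ⟧ ∎
    where open ≡-Reasoning
  ... | no N≢c = begin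
    Σ₁ N (λ k → f k * ⟦ k ≟ c ⟧) + f (suc N) * 0
      ≡⟨ cong₂ _+_ (Σ₁-indicator N f c 1≤c) (*-zeroʳ (f (suc N))) ⟩
    f c * ⟦ c ≤? N ⟧ + 0
      ≡⟨ +-identityʳ _ ⟩
    f c * ⟦ c ≤? N ⟧
      ≡⟨ cong (f c *_) (⟦⟧-cong (c ≤? N) (c ≤? suc N) m≤n⇒m≤1+n λ c≤ → s≤s⁻¹ (≤∧≢⇒< c≤ (≢-sym N≢c))) ⟩
    f c * ⟦ c ≤? suc N ⟧ ∎
    where open ≡-Reasoning

  -- The substitution k = m q. The new index keeps the range up to N, and the bracket does the
  -- cutting, so that this sum can still be interchanged with others.
  Σ₁-multiples : ∀ N (f : ℕ → ℕ) q → 1 ≤ q →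
    Σ₁ N (λ k → f k * ⟦ q ∣? k ⟧) ≡ Σ₁ N (λ m → f (m * q) * ⟦ m * q ≤? N ⟧)
  Σ₁-multiples N f q 1≤q = begin
    Σ₁ N (λ k → f k * ⟦ q ∣? k ⟧)
      ≡⟨ Σ₁-cong N expand ⟩
    Σ₁ N (λ k → Σ₁ N (λ m → f k * ⟦ k ≟ m * q ⟧))
      ≡⟨ Σ₁-swap N N (λ k m → f k * ⟦ k ≟ m * q ⟧) ⟩
    Σ₁ N (λ m → Σ₁ N (λ k → f k * ⟦ k ≟ m * q ⟧))
      ≡⟨ Σ₁-cong N (λ m 1≤m _ → Σ₁-indicator N f (m * q) (*-mono-≤ 1≤m 1≤q)) ⟩
    Σ₁ N (λ m → f (m * q) * ⟦ m * q ≤? N ⟧) ∎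
    where
    open ≡-Reasoning
    instance
      q≢0 : NonZero q
      q≢0 = >-nonZero 1≤q
    -- The bracket for q ∣ k is the number of m ≤ N with k = m q: the cofactor is unique, and it is
    -- at most k.
    expand : ∀ k → 1 ≤ k → k ≤ N → f k * ⟦ q ∣? k ⟧ ≡ Σ₁ N (λ m → f k * ⟦ k ≟ m * q ⟧)
    expand k 1≤k k≤N with q ∣? k
    ... | no q∤k = trans (*-zeroʳ (f k)) (sym (trans
      (Σ₁-cong N λ m _ _ → trans (cong (f k *_) (⟦⟧-no (k ≟ m * q) λ { refl → q∤k (n∣m*n m) })) (*-zeroʳ (f k)))
      (Σ₁-0 N)))
    ... | yes (divides zero refl) = contradiction 1≤k λ ()
    ... | yes (divides c@(suc _) refl) = sym (begin
      Σ₁ N (λ m → f (c * q) * ⟦ c * q ≟ m * q ⟧)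
        ≡⟨ Σ₁-cong N (λ m _ _ → cong (f (c * q) *_) (⟦⟧-cong (c * q ≟ m * q) (m ≟ c)
             (λ eq → sym (*-cancelʳ-≡ c m q eq)) λ { refl → refl })) ⟩
      Σ₁ N (λ m → f (c * q) * ⟦ m ≟ c ⟧)
        ≡⟨ Σ₁-indicator N (λ _ → f (c * q)) c (s≤s z≤n) ⟩
      f (c * q) * ⟦ c ≤? N ⟧
        ≡⟨ cong (f (c * q) *_) (⟦⟧-yes (c ≤? N) (≤-trans (m≤m*n c q) k≤N)) ⟩
      f (c * q) * 1 ∎)

  -- Coprimality

  χ : ℕ → ℕ → ℕ
  χ n k = ⟦ gcd k n ≟ 1 ⟧

  χ≤1 : ∀ n k → χ n k ≤ 1
  χ≤1 n k = ⟦⟧≤1 (gcd k n ≟ 1)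

  χ-cong : ∀ {n k n′ k′} → (Coprime k n → Coprime k′ n′) → (Coprime k′ n′ → Coprime k n) → χ n k ≡ χ n′ k′
  χ-cong {n} {k} {n′} {k′} f g = ⟦⟧-cong (gcd k n ≟ 1) (gcd k′ n′ ≟ 1)
    (coprime⇒gcd≡1 ∘ f ∘ gcd≡1⇒coprime) (coprime⇒gcd≡1 ∘ g ∘ gcd≡1⇒coprime)

  χ-yes : ∀ n k → Coprime k n → χ n k ≡ 1
  χ-yes n k c = ⟦⟧-yes (gcd k n ≟ 1) (coprime⇒gcd≡1 c)

  χ-no : ∀ n k → ¬ Coprime k n → χ n k ≡ 0
  χ-no n k ¬c = ⟦⟧-no (gcd k n ≟ 1) (¬c ∘ gcd≡1⇒coprime)

  χ1 : ∀ k → χ 1 k ≡ 1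
  χ1 k = χ-yes 1 k (Coprime.sym (Coprime.1-coprimeTo k))

  coprime-* : ∀ {a b n} → Coprime a n → Coprime b n → Coprime (a * b) n
  coprime-* {a} {b} {n} ca cb {d} (d∣ab , d∣n) =
    cb (coprime-divisor (λ (e∣d , e∣a) → ca (e∣a , ∣-trans e∣d d∣n)) d∣ab , d∣n)

  χ-* : ∀ n a b → χ n (a * b) ≡ χ n a * χ n b
  χ-* n a b with gcd a n ≟ 1 | gcd b n ≟ 1
  ... | yes ca | yes cb = χ-yes n (a * b) (coprime-* {a} {b} (gcd≡1⇒coprime ca) (gcd≡1⇒coprime cb))
  ... | yes _  | no ¬cb = χ-no n (a * b) λ c → ¬cb (coprime⇒gcd≡1 {b} λ (d∣b , d∣n) → c (∣n⇒∣m*n a d∣b , d∣n))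
  ... | no ¬ca | _      = χ-no n (a * b) λ c → ¬ca (coprime⇒gcd≡1 {a} λ (d∣a , d∣n) → c (∣m⇒∣m*n {m = a} b d∣a , d∣n))

  χ-^ : ∀ n p a → 1 ≤ a → χ n (p ^ a) ≡ χ n p
  χ-^ n p 1             _ = cong (χ n) (*-identityʳ p)
  χ-^ n p (suc a@(suc _)) _ = trans (χ-* n p (p ^ a)) (trans (cong (χ n p *_) (χ-^ n p a (s≤s z≤n))) idem)
    where
    idem : χ n p * χ n p ≡ χ n p
    idem with gcd p n ≟ 1
    ... | yes _ = refl
    ... | no  _ = refl

  prime∤⇒coprime : ∀ {p m} → Prime p → ¬ p ∣ m → Coprime p m
  prime∤⇒coprime pp p∤m {d} (d∣p , d∣m) with prime⇒irreducible pp d∣p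
  ... | inj₁ d≡1 = d≡1
  ... | inj₂ refl = contradiction d∣m p∤m

  prime>1 : ∀ {p} → Prime p → 1 < p
  prime>1 {p} pp = nonTrivial⇒n>1 p {{prime⇒nonTrivial pp}}

  -- As p is prime, an m coprime to n fails to be coprime to p n exactly when p ∣ m.
  χ-prime* : ∀ {p} → Prime p → ∀ n m → χ n m ≡ χ (p * n) m + χ n m * ⟦ p ∣? m ⟧
  χ-prime* {p} pp n m with p ∣? m
  ... | yes p∣m = sym (trans (cong (_+ χ n m * 1) (χ-no (p * n) m λ c →
          <⇒≢ (prime>1 pp) (sym (c (p∣m , m∣m*n n)))))
        (*-identityʳ (χ n m)))
  ... | no  p∤m = sym (trans (cong (χ (p * n) m +_) (*-zeroʳ (χ n m))) (trans (+-identityʳ _) (χ-cong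
          (λ c (d∣m , d∣n) → c (d∣m , ∣n⇒∣m*n p d∣n))
          (λ c → Coprime.sym (coprime-* {p} {n} (prime∤⇒coprime pp p∤m) (Coprime.sym c))))))

  χ-periodic : ∀ n k → χ n (n + k) ≡ χ n k
  χ-periodic n k = χ-cong {n} {n + k} (λ c (d∣k , d∣n) → c (∣m∣n⇒∣m+n d∣n d∣k , d∣n)) coprime-+

  Σ₁-χ-periods : ∀ t n → Σ₁ (t * n) (χ n) ≡ t * Σ₁ n (χ n)
  Σ₁-χ-periods zero    n = refl
  Σ₁-χ-periods (suc t) n = trans (Σ₁-++ n (t * n) (χ n)) (cong (Σ₁ n (χ n) +_)
    (trans (Σ₁-cong (t * n) λ k _ _ → χ-periodic n k) (Σ₁-χ-periods t n)))

  -- The weighted count of the integers coprime to n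

  infixl 7 _÷_

  -- Total, so that a summation index can be the divisor without a `NonZero` instance; the indices
  -- start at 1.
  _÷_ : ℕ → ℕ → ℕ
  x ÷ zero      = 0
  x ÷ m@(suc _) = x / m

  ≤÷⇒*≤ : ∀ {x m q} → q ≤ x ÷ m → m * q ≤ x
  ≤÷⇒*≤ {x} {zero}  {q} h = z≤n
  ≤÷⇒*≤ {x} {suc m} {q} h = begin
    suc m * q             ≤⟨ *-monoʳ-≤ (suc m) h ⟩
    suc m * (x / suc m)   ≡⟨ *-comm (suc m) (x / suc m) ⟩
    x / suc m * suc m     ≤⟨ m/n*n≤m x (suc m) ⟩
    x                     ∎
    where open ≤-Reasoning

  *≤⇒≤÷ : ∀ {x m q} → 1 ≤ m → m * q ≤ x → q ≤ x ÷ m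
  *≤⇒≤÷ {x} {suc m} {q} _ h = begin
    q                   ≡⟨ m*n/n≡m q (suc m) ⟨
    q * suc m / suc m   ≤⟨ /-monoˡ-≤ (suc m) (≤-trans (≤-reflexive (*-comm q (suc m))) h) ⟩
    x / suc m           ∎
    where open ≤-Reasoning

  ÷-antitone : ∀ {x m m′} → 1 ≤ m → m ≤ m′ → x ÷ m′ ≤ x ÷ m
  ÷-antitone {x} {m} {m′} 1≤m m≤m′ = *≤⇒≤÷ 1≤m (≤-trans (*-monoˡ-≤ (x ÷ m′) m≤m′) (≤÷⇒*≤ {x} {m′} ≤-refl))

  -- X times Σ 1/m over the m ≤ y coprime to n, with each term rounded down.
  weight : ℕ → ℕ → ℕ → ℕ
  weight n X y = Σ₁ y (λ m → χ n m * (X ÷ m))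

  *-interchangeʳ : ∀ a b c → a * b * c ≡ a * c * b
  *-interchangeʳ = solve-∀

  -- Up to p n there are p periods of integers coprime to n. Those divisible by p are the m p with m
  -- ≤ n coprime to n, and they occur only if p is itself coprime to n. This is φ(p n) = (p - χ n p)
  -- φ(n), one formula for p ∣ n and for p ∤ n, written without subtraction.
  Σ₁-χ-prime* : ∀ {p} → Prime p → ∀ n → Σ₁ (p * n) (χ (p * n)) + χ n p * Σ₁ n (χ n) ≡ p * Σ₁ n (χ n)
  Σ₁-χ-prime* {p} pp n = begin
    Σ₁ (p * n) (χ (p * n)) + χ n p * Σ₁ n (χ n)
      ≡⟨ cong (Σ₁ (p * n) (χ (p * n)) +_) multiples ⟨
    Σ₁ (p * n) (χ (p * n)) + Σ₁ (p * n) (λ k → χ n k * ⟦ p ∣? k ⟧)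
      ≡⟨ Σ₁-+ (p * n) (χ (p * n)) (λ k → χ n k * ⟦ p ∣? k ⟧) ⟨
    Σ₁ (p * n) (λ k → χ (p * n) k + χ n k * ⟦ p ∣? k ⟧)
      ≡⟨ Σ₁-cong (p * n) (λ k _ _ → χ-prime* pp n k) ⟨
    Σ₁ (p * n) (χ n)
      ≡⟨ Σ₁-χ-periods p n ⟩
    p * Σ₁ n (χ n) ∎
    where
    open ≡-Reasoning
    instance
      p≢0 : NonZero p
      p≢0 = prime⇒nonZero pp
    truncate : ∀ M N f → Σ₁ N f ≡ Σ₁ (N + M) (λ k → f k * ⟦ k ≤? N ⟧)
    truncate M N f = sym (trans (Σ₁-++ N M (λ k → f k * ⟦ k ≤? N ⟧)) (trans (cong₂ _+_
      (Σ₁-cong N λ k _ k≤N → trans (cong (f k *_) (⟦⟧-yes (k ≤? N) k≤N)) (*-identityʳ (f k)))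
      (trans (Σ₁-cong M λ k 1≤k _ → trans (cong (f (N + k) *_)
         (⟦⟧-no (N + k ≤? N) (<⇒≱ (≤-trans (≤-reflexive (+-comm 1 N)) (+-monoʳ-≤ N 1≤k))))) (*-zeroʳ (f (N + k))))
        (Σ₁-0 M)))
      (+-identityʳ _)))
    multiples : Σ₁ (p * n) (λ k → χ n k * ⟦ p ∣? k ⟧) ≡ χ n p * Σ₁ n (χ n)
    multiples = begin
      Σ₁ (p * n) (λ k → χ n k * ⟦ p ∣? k ⟧)
        ≡⟨ Σ₁-multiples (p * n) (χ n) p (<⇒≤ (prime>1 pp)) ⟩
      Σ₁ (p * n) (λ m → χ n (m * p) * ⟦ m * p ≤? p * n ⟧)
        ≡⟨ Σ₁-cong (p * n) (λ m _ _ → trans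
             (cong₂ _*_ (trans (χ-* n m p) (*-comm (χ n m) (χ n p)))
               (⟦⟧-cong (m * p ≤? p * n) (m ≤? n)
                 (λ h → *-cancelˡ-≤ p (≤-trans (≤-reflexive (*-comm p m)) h))
                 (λ h → ≤-trans (≤-reflexive (*-comm m p)) (*-monoʳ-≤ p h))))
             (*-assoc (χ n p) (χ n m) ⟦ m ≤? n ⟧)) ⟩
      Σ₁ (p * n) (λ m → χ n p * (χ n m * ⟦ m ≤? n ⟧))
        ≡⟨ Σ₁-*ˡ (p * n) (χ n p) (λ m → χ n m * ⟦ m ≤? n ⟧) ⟩
      χ n p * Σ₁ (p * n) (λ m → χ n m * ⟦ m ≤? n ⟧)
        ≡⟨ cong (λ N → χ n p * Σ₁ N (λ m → χ n m * ⟦ m ≤? n ⟧)) (m+[n∸m]≡n (m≤n*m n p)) ⟨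
      χ n p * Σ₁ (n + (p * n ∸ n)) (λ m → χ n m * ⟦ m ≤? n ⟧)
        ≡⟨ cong (χ n p *_) (truncate (p * n ∸ n) n (χ n)) ⟨
      χ n p * Σ₁ n (χ n) ∎

  -- Passing from n to p n discards the multiples m p, and p ⌊X/(m p)⌋ ≤ ⌊X/m⌋.
  weight-prime* : ∀ {p} → Prime p → ∀ n X y → p * weight n X y ≤ p * weight (p * n) X y + χ n p * weight n X y
  weight-prime* {p} pp n X y = begin
    p * weight n X y
      ≡⟨ cong (p *_) (trans (Σ₁-cong y λ m _ _ → trans (cong (_* (X ÷ m)) (χ-prime* pp n m))
           (*-distribʳ-+ (X ÷ m) (χ (p * n) m) (χ n m * ⟦ p ∣? m ⟧)))
           (Σ₁-+ y (λ m → χ (p * n) m * (X ÷ m)) (λ m → χ n m * ⟦ p ∣? m ⟧ * (X ÷ m)))) ⟩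
    p * (weight (p * n) X y + Σ₁ y (λ m → χ n m * ⟦ p ∣? m ⟧ * (X ÷ m)))
      ≡⟨ *-distribˡ-+ p (weight (p * n) X y) _ ⟩
    p * weight (p * n) X y + p * Σ₁ y (λ m → χ n m * ⟦ p ∣? m ⟧ * (X ÷ m))
      ≤⟨ +-monoʳ-≤ (p * weight (p * n) X y) multiples ⟩
    p * weight (p * n) X y + χ n p * weight n X y ∎
    where
    open ≤-Reasoning
    shrink : ∀ m → 1 ≤ m → p * (X ÷ (m * p)) ≤ X ÷ m
    shrink m 1≤m = *≤⇒≤÷ 1≤m (≤-trans (≤-reflexive (sym (*-assoc m p (X ÷ (m * p))))) (≤÷⇒*≤ {X} {m * p} ≤-refl))
    rearrange : ∀ p a b w i → p * (a * b * w * i) ≡ b * (a * (p * w)) * i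
    rearrange = solve-∀
    multiples : p * Σ₁ y (λ m → χ n m * ⟦ p ∣? m ⟧ * (X ÷ m)) ≤ χ n p * weight n X y
    multiples = begin
      p * Σ₁ y (λ m → χ n m * ⟦ p ∣? m ⟧ * (X ÷ m))
        ≡⟨ cong (p *_) (Σ₁-cong y λ m _ _ → *-interchangeʳ (χ n m) ⟦ p ∣? m ⟧ (X ÷ m)) ⟩
      p * Σ₁ y (λ m → χ n m * (X ÷ m) * ⟦ p ∣? m ⟧)
        ≡⟨ cong (p *_) (Σ₁-multiples y (λ m → χ n m * (X ÷ m)) p (<⇒≤ (prime>1 pp))) ⟩
      p * Σ₁ y (λ m → χ n (m * p) * (X ÷ (m * p)) * ⟦ m * p ≤? y ⟧)
        ≡⟨ Σ₁-*ˡ y p (λ m → χ n (m * p) * (X ÷ (m * p)) * ⟦ m * p ≤? y ⟧) ⟨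
      Σ₁ y (λ m → p * (χ n (m * p) * (X ÷ (m * p)) * ⟦ m * p ≤? y ⟧))
        ≤⟨ Σ₁-mono y (λ m 1≤m _ → begin
             p * (χ n (m * p) * (X ÷ (m * p)) * ⟦ m * p ≤? y ⟧)
               ≡⟨ cong (λ x → p * (x * (X ÷ (m * p)) * ⟦ m * p ≤? y ⟧)) (χ-* n m p) ⟩
             p * (χ n m * χ n p * (X ÷ (m * p)) * ⟦ m * p ≤? y ⟧)
               ≡⟨ rearrange p (χ n m) (χ n p) (X ÷ (m * p)) ⟦ m * p ≤? y ⟧ ⟩
             χ n p * (χ n m * (p * (X ÷ (m * p)))) * ⟦ m * p ≤? y ⟧
               ≤⟨ *-mono-≤ (*-monoʳ-≤ (χ n p) (*-monoʳ-≤ (χ n m) (shrink m 1≤m))) (⟦⟧≤1 (m * p ≤? y)) ⟩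
             χ n p * (χ n m * (X ÷ m)) * 1
               ≡⟨ *-identityʳ _ ⟩
             χ n p * (χ n m * (X ÷ m)) ∎) ⟩
      Σ₁ y (λ m → χ n p * (χ n m * (X ÷ m)))
        ≡⟨ Σ₁-*ˡ y (χ n p) (λ m → χ n m * (X ÷ m)) ⟩
      χ n p * weight n X y ∎

  -- Adjoining a prime p multiplies φ(n)/n by exactly 1 - e/p, where e is `χ n p`, and the weight by
  -- at least the same factor. A repeated prime has e = 0, so multiplicities need no separate
  -- treatment.
  density-primes : ∀ X y {ps} → All Prime ps → let n = product ps in
    Σ₁ n (χ n) * weight 1 X y ≤ n * weight n X y
  density-primes X y [] = ≤-refl
  density-primes X y {p ∷ ps} (pp ∷ pps) = begin
    Σ₁ (p * n) (χ (p * n)) * W 1   ≡⟨ cong (_* W 1) count ⟩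
    d * Σ₁ n (χ n) * W 1           ≡⟨ *-assoc d (Σ₁ n (χ n)) (W 1) ⟩
    d * (Σ₁ n (χ n) * W 1)         ≤⟨ *-monoʳ-≤ d (density-primes X y pps) ⟩
    d * (n * W n)                  ≡⟨ rearrange d n (W n) ⟩
    n * (d * W n)                  ≤⟨ *-monoʳ-≤ n sieve ⟩
    n * (p * W (p * n))            ≡⟨ rearrange′ n p (W (p * n)) ⟩
    p * n * W (p * n)              ∎
    where
    open ≤-Reasoning
    n e d : ℕ
    n = product ps
    e = χ n p
    d = p ∸ e
    W : ℕ → ℕ
    W k = weight k X y
    p≡d+e : d + e ≡ p
    p≡d+e = m∸n+n≡m (≤-trans (χ≤1 n p) (<⇒≤ (prime>1 pp)))
    count : Σ₁ (p * n) (χ (p * n)) ≡ d * Σ₁ n (χ n)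
    count = +-cancelʳ-≡ (e * Σ₁ n (χ n)) _ _ (trans (Σ₁-χ-prime* pp n)
      (trans (cong (_* Σ₁ n (χ n)) (sym p≡d+e)) (*-distribʳ-+ (Σ₁ n (χ n)) d e)))
    sieve : d * W n ≤ p * W (p * n)
    sieve = +-cancelʳ-≤ (e * W n) _ _ (≤-trans (≤-reflexive (trans (sym (*-distribʳ-+ (W n) d e))
      (cong (_* W n) p≡d+e))) (weight-prime* pp n X y))
    rearrange : ∀ a b c → a * (b * c) ≡ b * (a * c)
    rearrange = solve-∀
    rearrange′ : ∀ a b c → a * (b * c) ≡ b * a * c
    rearrange′ = solve-∀

  density : ∀ n → 1 ≤ n → ∀ X y → Σ₁ n (χ n) * weight 1 X y ≤ n * weight n X y
  density n 1≤n X y = subst (λ n → Σ₁ n (χ n) * weight 1 X y ≤ n * weight n X y)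
    (sym (PrimeFactorisation.isFactorisation f)) (density-primes X y (PrimeFactorisation.factorsPrime f))
    where f = factorise n {{>-nonZero 1≤n}}

  -- Prime factorisations

  -- Lets a product over primes run over all of 1, ..., K: a composite index contributes a power of
  -- 1.
  primeOr1 : ℕ → ℕ
  primeOr1 p with prime? p
  ... | yes _ = p
  ... | no  _ = 1

  primeOr1-prime : ∀ {p} → Prime p → primeOr1 p ≡ p
  primeOr1-prime {p} pp with prime? p
  ... | yes _  = refl
  ... | no ¬pp = contradiction pp ¬pp

  primeOr1-cong : ∀ p {e e′} → (Prime p → e ≡ e′) → primeOr1 p ^ e ≡ primeOr1 p ^ e′
  primeOr1-cong p {e} {e′} h with prime? p
  ... | yes pp = cong (p ^_) (h pp)
  ... | no  _  = trans (^-zeroˡ e) (sym (^-zeroˡ e′))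

  1≤primeOr1^ : ∀ p e → 1 ≤ primeOr1 p ^ e
  1≤primeOr1^ p e with prime? p
  ... | yes pp = m^n>0 p {{prime⇒nonZero pp}} e
  ... | no  _  = ≤-reflexive (sym (^-zeroˡ e))

  primeOr1-mono : ∀ p {e e′} → e ≤ e′ → primeOr1 p ^ e ≤ primeOr1 p ^ e′
  primeOr1-mono p {e} {e′} e≤e′ with prime? p
  ... | yes pp = ^-monoʳ-≤ p {{prime⇒nonZero pp}} e≤e′
  ... | no  _  = ≤-reflexive (trans (^-zeroˡ e) (sym (^-zeroˡ e′)))

  -- The exponent of the prime p in k, provided 1 ≤ k ≤ K.
  valuation : ℕ → ℕ → ℕ → ℕ
  valuation K p k = Σ₁ K (λ a → ⟦ p ^ a ∣? k ⟧)

  n<2^n : ∀ n → n < 2 ^ n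
  n<2^n zero    = ≤-refl
  n<2^n (suc n) = begin-strict
    suc n            ≤⟨ n<2^n n ⟩
    2 ^ n            <⟨ m<m+n (2 ^ n) (m^n>0 2 n) ⟩
    2 ^ n + 2 ^ n    ≡⟨ cong (2 ^ n +_) (+-identityʳ (2 ^ n)) ⟨
    2 ^ suc n        ∎
    where open ≤-Reasoning

  n<prime^n : ∀ {p} → Prime p → ∀ n → n < p ^ n
  n<prime^n pp n = <-≤-trans (n<2^n n) (^-monoˡ-≤ n (prime>1 pp))

  coprime-^ : ∀ {p q} → Coprime p q → ∀ a → Coprime (p ^ a) q
  coprime-^ {p} {q} c zero    = Coprime.1-coprimeTo q
  coprime-^ {p} {q} c (suc a) = coprime-* {p} {p ^ a} c (coprime-^ c a)

  valuation-1 : ∀ K {p} → Prime p → valuation K p 1 ≡ 0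
  valuation-1 K {p} pp = trans (Σ₁-cong K λ a 1≤a _ → ⟦⟧-no (p ^ a ∣? 1) λ d →
    <⇒≱ (≤-<-trans 1≤a (n<prime^n pp a)) (∣⇒≤ d)) (Σ₁-0 K)

  valuation-prime* : ∀ {K p q k} → Prime p → Prime q → 1 ≤ k → k ≤ K →
                     valuation K p (q * k) ≡ valuation K p k + ⟦ p ≟ q ⟧
  valuation-prime* {K} {p} {q} {k} pp pq 1≤k k≤K with p ≟ q
  ... | no p≢q = trans (Σ₁-cong K λ a _ _ → ⟦⟧-cong (p ^ a ∣? q * k) (p ^ a ∣? k)
          (coprime-divisor (coprime-^ (prime∤⇒coprime pp p∤q) a)) (∣n⇒∣m*n q))
        (sym (+-identityʳ _))
    where
    p∤q : ¬ p ∣ q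
    p∤q p∣q with prime⇒irreducible pq p∣q
    ... | inj₁ p≡1 = contradiction (sym p≡1) (<⇒≢ (prime>1 pp))
    ... | inj₂ p≡q = p≢q p≡q
  valuation-prime* {zero} pp pq 1≤k k≤0 | yes _ = contradiction (≤-trans 1≤k k≤0) λ ()
  valuation-prime* {suc K} {p} {.p} {k} pp _ 1≤k k≤K | yes refl = begin
    Σ₁ (1 + K) (λ a → ⟦ p ^ a ∣? p * k ⟧)
      ≡⟨ Σ₁-++ 1 K (λ a → ⟦ p ^ a ∣? p * k ⟧) ⟩
    ⟦ p ^ 1 ∣? p * k ⟧ + Σ₁ K (λ a → ⟦ p * p ^ a ∣? p * k ⟧)
      ≡⟨ cong₂ _+_ (⟦⟧-yes (p ^ 1 ∣? p * k) (*-monoʳ-∣ p (1∣ k)))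
           (Σ₁-cong K λ a _ _ → ⟦⟧-cong (p * p ^ a ∣? p * k) (p ^ a ∣? k)
             (*-cancelˡ-∣ p {{prime⇒nonZero pp}}) (*-monoʳ-∣ p)) ⟩
    1 + Σ₁ K (λ a → ⟦ p ^ a ∣? k ⟧)
      ≡⟨ +-comm 1 _ ⟩
    Σ₁ K (λ a → ⟦ p ^ a ∣? k ⟧) + 1
      ≡⟨ cong (_+ 1) (trans (cong (Σ₁ K (λ a → ⟦ p ^ a ∣? k ⟧) +_) last) (+-identityʳ _)) ⟨
    Σ₁ (1 + K) (λ a → ⟦ p ^ a ∣? k ⟧) + 1 ∎
    where
    open ≡-Reasoning
    -- Cancelling p shifts the exponents by one and loses the top one, which no k with k ≤ `suc K` <
    -- `p ^ suc K` can attain.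
    last : ⟦ p ^ suc K ∣? k ⟧ ≡ 0
    last = ⟦⟧-no (p ^ suc K ∣? k) (>⇒∤ {{>-nonZero 1≤k}} (≤-<-trans k≤K (n<prime^n pp (suc K))))

  Π₁-indicator : ∀ N (f : ℕ → ℕ) c → 1 ≤ c → c ≤ N → Π₁ N (λ k → f k ^ ⟦ k ≟ c ⟧) ≡ f c
  Π₁-indicator N f c 1≤c c≤N = begin
    Π₁ N (λ k → f k ^ ⟦ k ≟ c ⟧)
      ≡⟨ Π₁-cong N (λ k _ _ → replace k) ⟩
    Π₁ N (λ k → f c ^ ⟦ k ≟ c ⟧)
      ≡⟨ Π₁-^ʳ N (f c) (λ k → ⟦ k ≟ c ⟧) ⟩
    f c ^ Σ₁ N (λ k → ⟦ k ≟ c ⟧)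
      ≡⟨ cong (f c ^_) (Σ₁-cong N λ k _ _ → *-identityˡ ⟦ k ≟ c ⟧) ⟨
    f c ^ Σ₁ N (λ k → 1 * ⟦ k ≟ c ⟧)
      ≡⟨ cong (f c ^_) (trans (Σ₁-indicator N (λ _ → 1) c 1≤c) (trans (*-identityˡ _) (⟦⟧-yes (c ≤? N) c≤N))) ⟩
    f c ^ 1
      ≡⟨ *-identityʳ (f c) ⟩
    f c ∎
    where
    open ≡-Reasoning
    replace : ∀ k → f k ^ ⟦ k ≟ c ⟧ ≡ f c ^ ⟦ k ≟ c ⟧
    replace k with k ≟ c
    ... | yes refl = refl
    ... | no  _    = refl

  factorisation-primes : ∀ K {qs} → All Prime qs → product qs ≤ K →
    Π₁ K (λ p → primeOr1 p ^ valuation K p (product qs)) ≡ product qs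
  factorisation-primes K [] _ =
    trans (Π₁-cong K λ p _ _ → primeOr1-cong p {e′ = 0} (valuation-1 K)) (Π₁-1 K)
  factorisation-primes K {q ∷ qs} (pq ∷ pqs) qk≤K = begin
    Π₁ K (λ p → primeOr1 p ^ valuation K p (q * k))
      ≡⟨ Π₁-cong K (λ p _ _ → trans (primeOr1-cong p λ pp → valuation-prime* pp pq 1≤k k≤K)
           (^-distribˡ-+-* (primeOr1 p) (valuation K p k) ⟦ p ≟ q ⟧)) ⟩
    Π₁ K (λ p → primeOr1 p ^ valuation K p k * primeOr1 p ^ ⟦ p ≟ q ⟧)
      ≡⟨ Π₁-* K (λ p → primeOr1 p ^ valuation K p k) (λ p → primeOr1 p ^ ⟦ p ≟ q ⟧) ⟩
    Π₁ K (λ p → primeOr1 p ^ valuation K p k) * Π₁ K (λ p → primeOr1 p ^ ⟦ p ≟ q ⟧)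
      ≡⟨ cong₂ _*_ (factorisation-primes K pqs k≤K)
           (trans (Π₁-indicator K primeOr1 q (<⇒≤ (prime>1 pq)) q≤K) (primeOr1-prime pq)) ⟩
    k * q
      ≡⟨ *-comm k q ⟩
    q * k ∎
    where
    open ≡-Reasoning
    k : ℕ
    k = product qs
    instance
      q≢0 : NonZero q
      q≢0 = prime⇒nonZero pq
      k≢0 : NonZero k
      k≢0 = productOfPrimes≢0 pqs
    1≤k : 1 ≤ k
    1≤k = productOfPrimes≥1 pqs
    k≤K : k ≤ K
    k≤K = ≤-trans (m≤n*m k q) qk≤K
    q≤K : q ≤ K
    q≤K = ≤-trans (m≤m*n q k) qk≤K

  factorisation : ∀ {K k} → 1 ≤ k → k ≤ K → Π₁ K (λ p → primeOr1 p ^ valuation K p k) ≡ k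
  factorisation {K} {k} 1≤k k≤K = subst (λ k → Π₁ K (λ p → primeOr1 p ^ valuation K p k) ≡ k) (sym isFactorisation)
    (factorisation-primes K factorsPrime (≤-trans (≤-reflexive (sym isFactorisation)) k≤K))
    where open PrimeFactorisation (factorise k {{>-nonZero 1≤k}})

  -- Chebyshev's function

  -- For p prime and 1 ≤ x ≤ K this is ⌊log_p x⌋, the exponent of p in lcm(1, ..., x).
  height : ℕ → ℕ → ℕ → ℕ
  height K p x = Σ₁ K (λ a → ⟦ p ^ a ≤? x ⟧)

  -- For K ≥ x this is exp (ψ(x)) with the primes dividing n left out,
  -- i.e. the part of lcm(1, …, x) that is coprime to n.
  expψ : ℕ → ℕ → ℕ → ℕ
  expψ K n x = Π₁ K (λ p → primeOr1 p ^ (χ n p * height K p x))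

  1≤expψ : ∀ K n x → 1 ≤ expψ K n x
  1≤expψ K n x = 1≤Π₁ K λ p → 1≤primeOr1^ p (χ n p * height K p x)

  height-mono : ∀ K p {x x′} → x ≤ x′ → height K p x ≤ height K p x′
  height-mono K p {x} {x′} x≤x′ = Σ₁-mono K λ a _ _ →
    ⟦⟧-mono (p ^ a ≤? x) (p ^ a ≤? x′) (λ h → ≤-trans h x≤x′)

  expψ-mono : ∀ K n {x x′} → x ≤ x′ → expψ K n x ≤ expψ K n x′
  expψ-mono K n x≤x′ = Π₁-mono K λ p _ _ → primeOr1-mono p (*-monoʳ-≤ (χ n p) (height-mono K p x≤x′))

  -- Both sides count the pairs (m, a) with 1 ≤ a ≤ K for which m p^a is at most ℓ and coprime to n.
  -- Because χ is completely multiplicative and a ≥ 1, coprimality of m p^a splits into a condition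
  -- on m and one on p; this is why the identity survives the restriction to integers coprime to n.
  Σ₁-valuation : ∀ K n ℓ {p} → Prime p →
    Σ₁ ℓ (λ k → valuation K p k * χ n k) ≡ Σ₁ ℓ (λ m → χ n p * height K p (ℓ ÷ m) * χ n m)
  Σ₁-valuation K n ℓ {p} pp = begin
    Σ₁ ℓ (λ k → valuation K p k * χ n k)
      ≡⟨ Σ₁-cong ℓ (λ k _ _ → trans (*-comm (valuation K p k) (χ n k)) (sym (Σ₁-*ˡ K (χ n k) (λ a → ⟦ p ^ a ∣? k ⟧)))) ⟩
    Σ₁ ℓ (λ k → Σ₁ K (λ a → χ n k * ⟦ p ^ a ∣? k ⟧))
      ≡⟨ Σ₁-swap ℓ K (λ k a → χ n k * ⟦ p ^ a ∣? k ⟧) ⟩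
    Σ₁ K (λ a → Σ₁ ℓ (λ k → χ n k * ⟦ p ^ a ∣? k ⟧))
      ≡⟨ Σ₁-cong K (λ a _ _ → Σ₁-multiples ℓ (χ n) (p ^ a) (m^n>0 p {{prime⇒nonZero pp}} a)) ⟩
    Σ₁ K (λ a → Σ₁ ℓ (λ m → χ n (m * p ^ a) * ⟦ m * p ^ a ≤? ℓ ⟧))
      ≡⟨ Σ₁-cong K (λ a 1≤a _ → Σ₁-cong ℓ λ m 1≤m _ → cong₂ _*_
           (trans (χ-* n m (p ^ a)) (cong (χ n m *_) (χ-^ n p a 1≤a)))
           (⟦⟧-cong (m * p ^ a ≤? ℓ) (p ^ a ≤? ℓ ÷ m) (*≤⇒≤÷ 1≤m) (≤÷⇒*≤ {ℓ} {m}))) ⟩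
    Σ₁ K (λ a → Σ₁ ℓ (λ m → χ n m * χ n p * ⟦ p ^ a ≤? ℓ ÷ m ⟧))
      ≡⟨ Σ₁-swap K ℓ (λ a m → χ n m * χ n p * ⟦ p ^ a ≤? ℓ ÷ m ⟧) ⟩
    Σ₁ ℓ (λ m → Σ₁ K (λ a → χ n m * χ n p * ⟦ p ^ a ≤? ℓ ÷ m ⟧))
      ≡⟨ Σ₁-cong ℓ (λ m _ _ → trans (Σ₁-*ˡ K (χ n m * χ n p) (λ a → ⟦ p ^ a ≤? ℓ ÷ m ⟧))
           (rearrange (χ n m) (χ n p) (height K p (ℓ ÷ m)))) ⟩
    Σ₁ ℓ (λ m → χ n p * height K p (ℓ ÷ m) * χ n m) ∎
    where
    open ≡-Reasoning
    rearrange : ∀ a b c → a * b * c ≡ b * c * a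
    rearrange = solve-∀

  Π₁-coprime : ∀ {K} n {ℓ} → ℓ ≤ K → Π₁ ℓ (λ k → k ^ χ n k) ≡ Π₁ ℓ (λ m → expψ K n (ℓ ÷ m) ^ χ n m)
  Π₁-coprime {K} n {ℓ} ℓ≤K = begin
    Π₁ ℓ (λ k → k ^ χ n k)
      ≡⟨ Π₁-cong ℓ (λ k 1≤k k≤ℓ → cong (_^ χ n k) (sym (factorisation 1≤k (≤-trans k≤ℓ ℓ≤K)))) ⟩
    Π₁ ℓ (λ k → Π₁ K (λ p → primeOr1 p ^ valuation K p k) ^ χ n k)
      ≡⟨ collect (λ p k → valuation K p k) ⟩
    Π₁ K (λ p → primeOr1 p ^ Σ₁ ℓ (λ k → valuation K p k * χ n k))
      ≡⟨ Π₁-cong K (λ p _ _ → primeOr1-cong p (Σ₁-valuation K n ℓ)) ⟩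
    Π₁ K (λ p → primeOr1 p ^ Σ₁ ℓ (λ m → χ n p * height K p (ℓ ÷ m) * χ n m))
      ≡⟨ collect (λ p m → χ n p * height K p (ℓ ÷ m)) ⟨
    Π₁ ℓ (λ m → expψ K n (ℓ ÷ m) ^ χ n m) ∎
    where
    open ≡-Reasoning
    -- An interchange of the two products, used forwards for the factorisations of the k and
    -- backwards to reassemble `expψ`.
    collect : ∀ (e : ℕ → ℕ → ℕ) → Π₁ ℓ (λ k → Π₁ K (λ p → primeOr1 p ^ e p k) ^ χ n k) ≡
                                   Π₁ K (λ p → primeOr1 p ^ Σ₁ ℓ (λ k → e p k * χ n k))
    collect e = begin
      Π₁ ℓ (λ k → Π₁ K (λ p → primeOr1 p ^ e p k) ^ χ n k)
        ≡⟨ Π₁-cong ℓ (λ k _ _ → trans (Π₁-^ˡ K (χ n k) (λ p → primeOr1 p ^ e p k))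
             (Π₁-cong K λ p _ _ → ^-*-assoc (primeOr1 p) (e p k) (χ n k))) ⟩
      Π₁ ℓ (λ k → Π₁ K (λ p → primeOr1 p ^ (e p k * χ n k)))
        ≡⟨ Π₁-swap ℓ K (λ k p → primeOr1 p ^ (e p k * χ n k)) ⟩
      Π₁ K (λ p → Π₁ ℓ (λ k → primeOr1 p ^ (e p k * χ n k)))
        ≡⟨ Π₁-cong K (λ p _ _ → Π₁-^ʳ ℓ (primeOr1 p) (λ k → e p k * χ n k)) ⟩
      Π₁ K (λ p → primeOr1 p ^ Σ₁ ℓ (λ k → e p k * χ n k)) ∎

  -- The case n = 1, which is Chebyshev's identity N! = ∏ lcm(1, ..., ⌊N/m⌋).
  factorial-expψ : ∀ {K N} → N ≤ K → Π₁ N id ≡ Π₁ N (λ m → expψ K 1 (N ÷ m))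
  factorial-expψ {K} {N} N≤K = trans (Π₁-cong N λ k _ _ → sym (^χ1 k k))
    (trans (Π₁-coprime 1 N≤K) (Π₁-cong N λ m _ _ → ^χ1 (expψ K 1 (N ÷ m)) m))
    where
    ^χ1 : ∀ a k → a ^ χ 1 k ≡ a
    ^χ1 a k = trans (cong (a ^_) (χ1 k)) (*-identityʳ a)

  -- The factor at each odd index 2j + 1 ≥ 3 is replaced by the larger one at 2j; the factor at 1
  -- stays.
  Π₁-antitone-odd : ∀ M f → (∀ j → 1 ≤ j → f (suc j) ≤ f j) →
    Π₁ (suc (2 * M)) f ≤ f 1 * (Π₁ M (λ j → f (2 * j)) * Π₁ M (λ j → f (2 * j)))
  Π₁-antitone-odd zero    f h = ≤-reflexive (*-comm 1 (f 1))
  Π₁-antitone-odd (suc M) f h = begin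
    Π₁ (suc (2 * suc M)) f
      ≡⟨ cong (λ n → Π₁ (suc n) f) (*-suc 2 M) ⟩
    Π₁ (suc (2 * M)) f * f (2 + 2 * M) * f (3 + 2 * M)
      ≤⟨ *-mono-≤ (*-monoˡ-≤ (f (2 + 2 * M)) (Π₁-antitone-odd M f h)) (h (2 + 2 * M) (s≤s z≤n)) ⟩
    f 1 * (E * E) * f (2 + 2 * M) * f (2 + 2 * M)
      ≡⟨ rearrange (f 1) E (f (2 + 2 * M)) ⟩
    f 1 * ((E * f (2 + 2 * M)) * (E * f (2 + 2 * M)))
      ≡⟨ cong (λ n → f 1 * ((E * f n) * (E * f n))) (*-suc 2 M) ⟨
    f 1 * (Π₁ (suc M) (λ j → f (2 * j)) * Π₁ (suc M) (λ j → f (2 * j))) ∎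
    where
    open ≤-Reasoning
    E : ℕ
    E = Π₁ M (λ j → f (2 * j))
    rearrange : ∀ a b c → a * (b * b) * c * c ≡ a * ((b * c) * (b * c))
    rearrange = solve-∀

  -- The central binomial coefficient is at least 2^M. From M to M + 1 the left side gains (M +
  -- 1)(2M + 2) and the right side (2M + 1)(2M + 2).
  2^M*M!²≤[2M]! : ∀ M → 2 ^ M * (Π₁ M id * Π₁ M id) ≤ Π₁ (2 * M) id
  2^M*M!²≤[2M]! zero    = ≤-refl
  2^M*M!²≤[2M]! (suc M) = begin
    2 ^ suc M * (F * suc M * (F * suc M))
      ≡⟨ rearrange (2 ^ M) F (suc M) ⟩
    2 ^ M * (F * F) * (suc M * (2 * suc M))
      ≤⟨ *-mono-≤ (2^M*M!²≤[2M]! M) (*-mono-≤ (s≤s (m≤m+n M (M + 0))) (≤-reflexive (*-suc 2 M))) ⟩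
    Π₁ (2 * M) id * (suc (2 * M) * (2 + 2 * M))
      ≡⟨ *-assoc (Π₁ (2 * M) id) (suc (2 * M)) (2 + 2 * M) ⟨
    Π₁ (2 + 2 * M) id
      ≡⟨ cong (λ n → Π₁ n id) (*-suc 2 M) ⟨
    Π₁ (2 * suc M) id ∎
    where
    open ≤-Reasoning
    F : ℕ
    F = Π₁ M id
    rearrange : ∀ a b c → 2 * a * (b * c * (b * c)) ≡ a * (b * b) * (c * (2 * c))
    rearrange = solve-∀

  1≤Π₁-id : ∀ N → 1 ≤ Π₁ N id
  1≤Π₁-id zero    = ≤-refl
  1≤Π₁-id (suc N) = *-mono-≤ (1≤Π₁-id N) (s≤s z≤n)

  -- Chebyshev: in (2M)! = ∏ expψ(2M/m) the even m contribute M! and, by monotonicity,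
  -- the odd m ≥ 3 contribute at most M!.
  2^M≤expψ : ∀ K M → 2 * M ≤ K → 2 ^ M ≤ expψ K 1 (2 * M)
  2^M≤expψ K M 2M≤K = *-cancelʳ-≤ (2 ^ M) (expψ K 1 (2 * M)) (F * F) {{>-nonZero (*-mono-≤ (1≤Π₁-id M) (1≤Π₁-id M))}} (begin
    2 ^ M * (F * F)                  ≤⟨ 2^M*M!²≤[2M]! M ⟩
    Π₁ (2 * M) id                    ≡⟨ factorial-expψ 2M≤K ⟩
    Π₁ (2 * M) f                     ≤⟨ Π₁-extend {2 * M} {suc (2 * M)} (n≤1+n (2 * M)) (λ m → 1≤expψ K 1 (2 * M ÷ m)) ⟩
    Π₁ (suc (2 * M)) f               ≤⟨ Π₁-antitone-odd M f (λ j 1≤j → expψ-mono K 1 (÷-antitone {2 * M} 1≤j (n≤1+n j))) ⟩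
    f 1 * (Π₁ M (λ j → f (2 * j)) * Π₁ M (λ j → f (2 * j)))
                                     ≡⟨ cong₂ (λ a b → a * (b * b)) (cong (expψ K 1) (n/1≡n (2 * M))) even ⟩
    expψ K 1 (2 * M) * (F * F)       ∎)
    where
    open ≤-Reasoning
    F : ℕ
    F = Π₁ M id
    f : ℕ → ℕ
    f m = expψ K 1 (2 * M ÷ m)
    halve : ∀ j → 1 ≤ j → 2 * M ÷ (2 * j) ≡ M ÷ j
    halve j@(suc _) _ = m*n/m*o≡n/o 2 M j
    even : Π₁ M (λ j → f (2 * j)) ≡ F
    even = trans (Π₁-cong M λ j 1≤j _ → cong (expψ K 1) (halve j 1≤j))
      (sym (factorial-expψ (≤-trans (m≤n*m M 2) 2M≤K)))

  -- Removing the primes that divide n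

  -- Induction on K. If even the top power p^(K+1) is at most x, the height is at most K + 1 merely
  -- as a count of K + 1 brackets; otherwise the top bracket is 0.
  ^height≤ : ∀ K {p x} → Prime p → 1 ≤ x → p ^ height K p x ≤ x
  ^height≤ zero    pp 1≤x = 1≤x
  ^height≤ (suc K) {p} {x} pp 1≤x with p ^ suc K ≤? x
  ... | yes h = ≤-trans (^-monoʳ-≤ p {{prime⇒nonZero pp}} bound) h
    where
    bound : height K p x + 1 ≤ suc K
    bound = ≤-trans (+-monoˡ-≤ 1 (≤-trans (Σ₁-mono K λ a _ _ → ⟦⟧≤1 (p ^ a ≤? x))
      (≤-reflexive (trans (Σ₁-const K 1) (*-identityʳ K))))) (≤-reflexive (+-comm K 1))
  ... | no  _ = ≤-trans (≤-reflexive (cong (p ^_) (+-identityʳ (height K p x)))) (^height≤ K pp 1≤x)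

  height≤1 : ∀ K {p x} → Prime p → x < p * p → height K p x ≤ 1
  height≤1 zero    pp h = z≤n
  height≤1 (suc zero) {p} {x} pp h = ⟦⟧≤1 (p ^ 1 ≤? x)
  height≤1 (suc K@(suc K′)) {p} {x} pp h = begin
    height K p x + ⟦ p ^ suc K ≤? x ⟧   ≡⟨ cong (height K p x +_) (⟦⟧-no (p ^ suc K ≤? x) (<⇒≱ (<-≤-trans h p²≤))) ⟩
    height K p x + 0                    ≡⟨ +-identityʳ _ ⟩
    height K p x                        ≤⟨ height≤1 K pp h ⟩
    1                                   ∎
    where
    open ≤-Reasoning
    p²≤ : p * p ≤ p ^ suc K
    p²≤ = ≤-trans (≤-reflexive (cong (p *_) (sym (*-identityʳ p))))
      (^-monoʳ-≤ p {{prime⇒nonZero pp}} (s≤s (s≤s (z≤n {K′}))))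

  1≤valuation : ∀ {K p n} → 1 ≤ K → p ∣ n → 1 ≤ valuation K p n
  1≤valuation {suc K} {p} {n} _ p∣n = begin
    1                                                            ≡⟨ ⟦⟧-yes (p ^ 1 ∣? n) (subst (_∣ n) (sym (*-identityʳ p)) p∣n) ⟨
    ⟦ p ^ 1 ∣? n ⟧                                               ≤⟨ m≤m+n ⟦ p ^ 1 ∣? n ⟧ _ ⟩
    ⟦ p ^ 1 ∣? n ⟧ + Σ₁ K (λ a → ⟦ p ^ suc a ∣? n ⟧)             ≡⟨ Σ₁-++ 1 K (λ a → ⟦ p ^ a ∣? n ⟧) ⟨
    valuation (suc K) p n                                        ∎
    where open ≤-Reasoning

  Σ₁-≤-indicator : ∀ N r → Σ₁ N (λ k → ⟦ k ≤? r ⟧) ≤ r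
  Σ₁-≤-indicator N r = ≤-trans (bound N) (m⊓n≤n N r)
    where
    bound : ∀ N → Σ₁ N (λ k → ⟦ k ≤? r ⟧) ≤ N ⊓ r
    bound zero    = z≤n
    bound (suc N) with suc N ≤? r
    ... | yes N<r = ⊓-glb (≤-trans (≤-reflexive (+-comm _ 1)) (s≤s N′)) (≤-trans (≤-reflexive (+-comm _ 1)) (≤-trans (s≤s N′) N<r))
      where N′ = ≤-trans (bound N) (m⊓n≤m N r)
    ... | no  _   = ≤-trans (≤-reflexive (+-identityʳ _)) (≤-trans (bound N) (⊓-monoˡ-≤ r (n≤1+n N)))

  -- A prime p ∣ n with p > r occurs at most once in expψ(x), and those p divide out of n;
  -- each of the at most r others contributes at most x.
  expψ-split : ∀ {K n x r} → 1 ≤ n → n ≤ K → 1 ≤ x → x < suc r * suc r →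
               expψ K 1 x ≤ expψ K n x * (n * x ^ r)
  expψ-split {K} {n} {x} {r} 1≤n n≤K 1≤x x<r² = begin
    Π₁ K (λ p → primeOr1 p ^ (χ 1 p * height K p x))
      ≤⟨ Π₁-mono K (λ p _ _ → pointwise p) ⟩
    Π₁ K (λ p → A p * (B p * C p))
      ≡⟨ trans (Π₁-* K A (λ p → B p * C p)) (cong (Π₁ K A *_) (Π₁-* K B C)) ⟩
    expψ K n x * (Π₁ K B * Π₁ K C)
      ≡⟨ cong₂ (λ a b → expψ K n x * (a * b)) (factorisation 1≤n n≤K) (Π₁-^ʳ K x (λ p → ⟦ p ≤? r ⟧)) ⟩
    expψ K n x * (n * x ^ Σ₁ K (λ p → ⟦ p ≤? r ⟧))
      ≤⟨ *-monoʳ-≤ (expψ K n x) (*-monoʳ-≤ n (^-monoʳ-≤ x (Σ₁-≤-indicator K r))) ⟩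
    expψ K n x * (n * x ^ r) ∎
    where
    open ≤-Reasoning
    instance
      x≢0 : NonZero x
      x≢0 = >-nonZero 1≤x
    A B C : ℕ → ℕ
    A p = primeOr1 p ^ (χ n p * height K p x)
    B p = primeOr1 p ^ valuation K p n
    C p = x ^ ⟦ p ≤? r ⟧
    1≤C : ∀ p → 1 ≤ C p
    1≤C p = m^n>0 x ⟦ p ≤? r ⟧
    ^height≤val : ∀ {p} → Prime p → p ∣ n → p ^ height K p x ≤ p ^ valuation K p n * C p
    ^height≤val {p} pp p∣n with p ≤? r
    ... | yes _ = ≤-trans (^height≤ K pp 1≤x) (≤-trans (≤-reflexive (sym (*-identityʳ x)))
            (m≤n*m (x * 1) (p ^ valuation K p n) {{m^n≢0 p (valuation K p n) {{prime⇒nonZero pp}}}}))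
    ... | no p≰r = ≤-trans (^-monoʳ-≤ p {{prime⇒nonZero pp}}
            (≤-trans (height≤1 K pp (<-≤-trans x<r² (*-mono-≤ (≰⇒> p≰r) (≰⇒> p≰r))))
                     (1≤valuation (≤-trans 1≤n n≤K) p∣n)))
            (≤-reflexive (sym (*-identityʳ _)))
    prime-case : ∀ {p} → Prime p →
      p ^ height K p x ≤ p ^ (χ n p * height K p x) * (p ^ valuation K p n * C p)
    prime-case {p} pp with p ∣? n
    ... | yes p∣n = ≤-trans (^height≤val pp p∣n)
            (m≤n*m _ (p ^ (χ n p * height K p x)) {{m^n≢0 p (χ n p * height K p x) {{prime⇒nonZero pp}}}})
    ... | no p∤n = ≤-trans (≤-reflexive (cong (p ^_) (sym (trans
              (cong (_* height K p x) (χ-yes n p (prime∤⇒coprime pp p∤n))) (*-identityˡ _)))))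
            (m≤m*n _ (p ^ valuation K p n * C p)
              {{m*n≢0 (p ^ valuation K p n) (C p) {{m^n≢0 p (valuation K p n) {{prime⇒nonZero pp}}}} {{>-nonZero (1≤C p)}}}})
    pointwise : ∀ p → primeOr1 p ^ (χ 1 p * height K p x) ≤ A p * (B p * C p)
    pointwise p with prime? p
    ... | yes pp = ≤-trans (≤-reflexive (cong (p ^_) (trans (cong (_* height K p x) (χ1 p)) (*-identityˡ _)))) (prime-case pp)
    ... | no  _  = begin
      1 ^ (χ 1 p * height K p x)
        ≡⟨ ^-zeroˡ (χ 1 p * height K p x) ⟩
      1
        ≤⟨ 1≤C p ⟩
      C p
        ≡⟨ trans (+-identityʳ _) (+-identityʳ _) ⟨
      1 * (1 * C p)
        ≡⟨ cong₂ (λ a b → a * (b * C p)) (^-zeroˡ (χ n p * height K p x)) (^-zeroˡ (valuation K p n)) ⟨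
      1 ^ (χ n p * height K p x) * (1 ^ valuation K p n * C p) ∎

  -- Integer logarithms and the quantitative lower bounds

  log-bracket : ∀ b → 2 ≤ b → ∀ x → 1 ≤ x → ∃ λ s → b ^ s ≤ x × x < b ^ suc s
  log-bracket b 2≤b 1 _ = 0 , ≤-refl , ≤-trans 2≤b (≤-reflexive (sym (*-identityʳ b)))
  log-bracket b 2≤b (suc x@(suc _)) _ with log-bracket b 2≤b x (s≤s z≤n)
  ... | s , lo , hi with suc x <? b ^ suc s
  ...   | yes lt = s , m≤n⇒m≤1+n lo , lt
  ...   | no  ≮  = suc s , ≮⇒≥ ≮ , ≤-<-trans hi (^-monoʳ-< b 2≤b (n<1+n (suc s)))

  log-bracket-≥ : ∀ b {h s x} → 2 ≤ b → b ^ h ≤ x → x < b ^ suc s → h ≤ s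
  log-bracket-≥ b {h} {s} 2≤b lo hi with h ≤? s
  ... | yes h≤s = h≤s
  ... | no  h≰s = contradiction (<-≤-trans hi (≤-trans
          (^-monoʳ-≤ b {{>-nonZero (≤-trans (s≤s z≤n) 2≤b)}} (≰⇒> h≰s)) lo)) (<-irrefl refl)

  -- False at h = 8; this is the origin of the threshold 4^9 for x in `expψ-large`.
  32[1+h]≤2^h : ∀ h → 9 ≤ h → 32 * suc h ≤ 2 ^ h
  32[1+h]≤2^h h 9≤h = subst (λ h → 32 * suc h ≤ 2 ^ h) (m+[n∸m]≡n 9≤h) (go (h ∸ 9))
    where
    open ≤-Reasoning
    go : ∀ i → 32 * suc (9 + i) ≤ 2 ^ (9 + i)
    go zero    = m≤m+n 320 192
    go (suc i) = begin
      32 * suc (9 + suc i)          ≡⟨ cong (λ j → 32 * suc j) (+-suc 9 i) ⟩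
      32 * suc (suc (9 + i))        ≤⟨ *-monoʳ-≤ 32 {suc (suc (9 + i))} {suc (9 + i) + suc (9 + i)} (+-monoˡ-≤ (suc (9 + i)) {1} {suc (9 + i)} (s≤s z≤n)) ⟩
      32 * (suc (9 + i) + suc (9 + i)) ≡⟨ double 32 (suc (9 + i)) ⟩
      2 * (32 * suc (9 + i))        ≤⟨ *-monoʳ-≤ 2 (go i) ⟩
      2 ^ suc (9 + i)               ≡⟨ cong (2 ^_) (+-suc 9 i) ⟨
      2 ^ (9 + suc i)               ∎
      where
      double : ∀ a b → a * (b + b) ≡ 2 * (a * b)
      double = solve-∀

  -- Chebyshev gives about 2^(x/2), and removing the primes of n costs at most n x^r. Here 4^h ≤ x <
  -- 4^(h+1), and r = 2^(h+1) is a power of two above √x, so that x^r ≤ 2^B with B = 2 (h + 1) r ≤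
  -- x/8. The exponents D, t and B take at most x/8 each, together less than the x/2 available.
  expψ-large : ∀ {K n x t D} → 1 ≤ n → n ≤ K → x ≤ K → n ≤ 2 ^ t →
               8 * t ≤ x → 4 ^ 9 ≤ x → 8 * D ≤ x → 2 ^ D ≤ expψ K n x
  expψ-large {K} {n} {x} {t} {D} 1≤n n≤K x≤K n≤2^t 8t≤x 4^9≤x 8D≤x =
    *-cancelʳ-≤ (2 ^ D) (expψ K n x) (2 ^ (t + B)) {{m^n≢0 2 (t + B)}} (begin
      2 ^ D * 2 ^ (t + B)              ≡⟨ ^-distribˡ-+-* 2 D (t + B) ⟨
      2 ^ (D + (t + B))                ≤⟨ ^-monoʳ-≤ 2 exponents ⟩
      2 ^ M                            ≤⟨ 2^M≤expψ K M (≤-trans 2M≤x x≤K) ⟩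
      expψ K 1 (2 * M)                 ≤⟨ expψ-mono K 1 2M≤x ⟩
      expψ K 1 x                       ≤⟨ expψ-split {r = r} 1≤n n≤K 1≤x (<-≤-trans x<4^h (≤-trans (≤-reflexive (^-distribʳ-* (suc h) 2 2)) (*-mono-≤ (n≤1+n r) (n≤1+n r)))) ⟩
      expψ K n x * (n * x ^ r)         ≤⟨ *-monoʳ-≤ (expψ K n x) (*-mono-≤ n≤2^t x^r≤) ⟩
      expψ K n x * (2 ^ t * 2 ^ B)     ≡⟨ cong (expψ K n x *_) (^-distribˡ-+-* 2 t B) ⟨
      expψ K n x * 2 ^ (t + B)         ∎)
    where
    open ≤-Reasoning
    1≤x : 1 ≤ x
    1≤x = ≤-trans (m^n>0 4 9) 4^9≤x
    bracket = log-bracket 4 (s≤s (s≤s z≤n)) x 1≤x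
    h r M B : ℕ
    h = proj₁ bracket
    r = 2 ^ suc h
    M = x / 2
    B = 2 * suc h * r
    4^h≤x : 4 ^ h ≤ x
    4^h≤x = proj₁ (proj₂ bracket)
    x<4^h : x < 4 ^ suc h
    x<4^h = proj₂ (proj₂ bracket)
    9≤h : 9 ≤ h
    9≤h = log-bracket-≥ 4 (s≤s (s≤s z≤n)) 4^9≤x x<4^h
    2M≤x : 2 * M ≤ x
    2M≤x = ≤-trans (≤-reflexive (*-comm 2 M)) (m/n*n≤m x 2)
    x^r≤ : x ^ r ≤ 2 ^ B
    x^r≤ = begin
      x ^ r                  ≤⟨ ^-monoˡ-≤ r (<⇒≤ x<4^h) ⟩
      (4 ^ suc h) ^ r        ≡⟨ cong (_^ r) (^-*-assoc 2 2 (suc h)) ⟩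
      (2 ^ (2 * suc h)) ^ r  ≡⟨ ^-*-assoc 2 (2 * suc h) r ⟩
      2 ^ B                  ∎
    8B≤x : 8 * B ≤ x
    8B≤x = begin
      8 * (2 * suc h * (2 * 2 ^ h))  ≡⟨ rearrange (suc h) (2 ^ h) ⟩
      32 * suc h * 2 ^ h             ≤⟨ *-monoˡ-≤ (2 ^ h) (32[1+h]≤2^h h 9≤h) ⟩
      2 ^ h * 2 ^ h                  ≡⟨ ^-distribʳ-* h 2 2 ⟨
      4 ^ h                          ≤⟨ 4^h≤x ⟩
      x                              ∎
      where
      rearrange : ∀ a b → 8 * (2 * a * (2 * b)) ≡ 32 * a * b
      rearrange = solve-∀
    x≤1+2M : x ≤ 1 + 2 * M
    x≤1+2M = begin
      x                  ≡⟨ m≡m%n+[m/n]*n x 2 ⟩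
      x % 2 + M * 2      ≤⟨ +-mono-≤ (s≤s⁻¹ (m%n<n x 2)) (≤-reflexive (*-comm M 2)) ⟩
      1 + 2 * M          ∎
    -- The three eighths leave x/8 to spare, which pays for rounding x/2 down to M; the summand 4 is
    -- eight times the rounding loss ½, and 4 ≤ x.
    exponents : D + (t + B) ≤ M
    exponents = *-cancelˡ-≤ 8 (+-cancelʳ-≤ 4 (8 * (D + (t + B))) (8 * M) (begin
      8 * (D + (t + B)) + 4              ≡⟨ distrib D t B ⟩
      8 * D + 8 * t + 8 * B + 4          ≤⟨ +-mono-≤ (+-mono-≤ (+-mono-≤ 8D≤x 8t≤x) 8B≤x) (≤-trans (^-monoʳ-≤ 4 (s≤s (z≤n {8}))) 4^9≤x) ⟩
      x + x + x + x                      ≡⟨ four x ⟩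
      4 * x                              ≤⟨ *-monoʳ-≤ 4 x≤1+2M ⟩
      4 * (1 + 2 * M)                    ≡⟨ four′ M ⟩
      8 * M + 4                          ∎))
      where
      distrib : ∀ a b c → 8 * (a + (b + c)) + 4 ≡ 8 * a + 8 * b + 8 * c + 4
      distrib = solve-∀
      four : ∀ a → a + a + a + a ≡ 4 * a
      four = solve-∀
      four′ : ∀ a → 4 * (1 + 2 * a) ≡ 8 * a + 4
      four′ = solve-∀

  2^-cancel-≤ : ∀ {a b} → 2 ^ a ≤ 2 ^ b → a ≤ b
  2^-cancel-≤ {a} {b} h with a ≤? b
  ... | yes a≤b = a≤b
  ... | no  a≰b = contradiction (<-≤-trans (^-monoʳ-< 2 ≤-refl (≰⇒> a≰b)) h) (<-irrefl refl)

  -- `Π₁-coprime` on a base 2 logarithmic scale. On the left each k is at most 2^s. On the right the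
  -- factors with m > y are dropped, and for m ≤ y the quotient ℓ/m is at least Z, so `expψ-large`
  -- applies. Part (ii) takes y = 1 and Z = ℓ, part (i) takes y = Z near √ℓ.
  weight≤count : ∀ {n ℓ t y s Z} → 1 ≤ n → ℓ ≤ n → n ≤ 2 ^ t → ℓ ≤ 2 ^ s → y ≤ ℓ →
                 8 * t ≤ Z → 4 ^ 9 ≤ Z → y * Z ≤ ℓ → weight n (ℓ / 8) y ≤ s * Σ₁ ℓ (χ n)
  weight≤count {n} {ℓ} {t} {y} {s} {Z} 1≤n ℓ≤n n≤2^t ℓ≤2^s y≤ℓ 8t≤Z 4^9≤Z yZ≤ℓ = 2^-cancel-≤ (begin
    2 ^ weight n (ℓ / 8) y
      ≡⟨ Π₁-^ʳ y 2 (λ m → χ n m * (ℓ / 8 ÷ m)) ⟨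
    Π₁ y (λ m → 2 ^ (χ n m * (ℓ / 8 ÷ m)))
      ≡⟨ Π₁-cong y (λ m _ _ → trans (cong (2 ^_) (*-comm (χ n m) (ℓ / 8 ÷ m))) (sym (^-*-assoc 2 (ℓ / 8 ÷ m) (χ n m)))) ⟩
    Π₁ y (λ m → (2 ^ (ℓ / 8 ÷ m)) ^ χ n m)
      ≤⟨ Π₁-mono y (λ m 1≤m m≤y → ^-monoˡ-≤ (χ n m) (large m 1≤m m≤y)) ⟩
    Π₁ y (λ m → expψ n n (ℓ ÷ m) ^ χ n m)
      ≤⟨ Π₁-extend {y} {ℓ} y≤ℓ (λ m → m^n>0 (expψ n n (ℓ ÷ m)) {{>-nonZero (1≤expψ n n (ℓ ÷ m))}} (χ n m)) ⟩
    Π₁ ℓ (λ m → expψ n n (ℓ ÷ m) ^ χ n m)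
      ≡⟨ Π₁-coprime n ℓ≤n ⟨
    Π₁ ℓ (λ k → k ^ χ n k)
      ≤⟨ Π₁-mono ℓ (λ k _ k≤ℓ → ^-monoˡ-≤ (χ n k) (≤-trans k≤ℓ ℓ≤2^s)) ⟩
    Π₁ ℓ (λ k → (2 ^ s) ^ χ n k)
      ≡⟨ Π₁-^ʳ ℓ (2 ^ s) (χ n) ⟩
    (2 ^ s) ^ Σ₁ ℓ (χ n)
      ≡⟨ ^-*-assoc 2 s (Σ₁ ℓ (χ n)) ⟩
    2 ^ (s * Σ₁ ℓ (χ n)) ∎)
    where
    open ≤-Reasoning
    -- The bound K on primes and exponents is n itself, which dominates both ℓ and the prime factors
    -- of n.
    large : ∀ m → 1 ≤ m → m ≤ y → 2 ^ (ℓ / 8 ÷ m) ≤ expψ n n (ℓ ÷ m)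
    large m 1≤m m≤y = expψ-large {t = t} {D = ℓ / 8 ÷ m} 1≤n ≤-refl (≤-trans x≤ℓ ℓ≤n) n≤2^t (≤-trans 8t≤Z Z≤) (≤-trans 4^9≤Z Z≤)
      (*≤⇒≤÷ 1≤m (begin
        m * (8 * (ℓ / 8 ÷ m))   ≡⟨ rearrange m (ℓ / 8 ÷ m) ⟩
        m * (ℓ / 8 ÷ m) * 8     ≤⟨ *-monoˡ-≤ 8 (≤÷⇒*≤ {ℓ / 8} {m} ≤-refl) ⟩
        ℓ / 8 * 8               ≤⟨ m/n*n≤m ℓ 8 ⟩
        ℓ                       ∎))
      where
      rearrange : ∀ a b → a * (8 * b) ≡ a * b * 8
      rearrange = solve-∀
      Z≤ : Z ≤ ℓ ÷ m
      Z≤ = *≤⇒≤÷ 1≤m (≤-trans (*-monoˡ-≤ Z m≤y) yZ≤ℓ)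
      x≤ℓ : ℓ ÷ m ≤ ℓ
      x≤ℓ = ≤-trans (÷-antitone {ℓ} {1} {m} ≤-refl 1≤m) (≤-reflexive (n/1≡n ℓ))

  -- The dyadic block above 2^j has 2^j terms, each at least q = ⌊X/2^(j+1)⌋. Since q ≥ 1, rounding
  -- loses at most a factor 2, that is X ≤ 2^(j+2) q, so every block contributes at least X/4.
  harmonic : ∀ X j → 2 ^ j ≤ X → j * X ≤ 4 * Σ₁ (2 ^ j) (X ÷_)
  harmonic X zero    _ = z≤n
  harmonic X (suc j) h = begin
    X + j * X                               ≡⟨ +-comm X (j * X) ⟩
    j * X + X                               ≤⟨ +-mono-≤ (harmonic X j (≤-trans (m≤n*m (2 ^ j) 2) h)) block ⟩
    4 * Σ₁ (2 ^ j) (X ÷_) + 4 * upper       ≡⟨ *-distribˡ-+ 4 (Σ₁ (2 ^ j) (X ÷_)) upper ⟨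
    4 * (Σ₁ (2 ^ j) (X ÷_) + upper)         ≡⟨ cong (4 *_) (Σ₁-++ (2 ^ j) (2 ^ j + 0) (X ÷_)) ⟨
    4 * Σ₁ (2 ^ suc j) (X ÷_)               ∎
    where
    open ≤-Reasoning
    instance
      2^≢0 : NonZero (2 ^ suc j)
      2^≢0 = m^n≢0 2 (suc j)
    1≤2^ : 1 ≤ 2 ^ suc j
    1≤2^ = m^n>0 2 (suc j)
    upper q : ℕ
    upper = Σ₁ (2 ^ j + 0) (λ i → X ÷ (2 ^ j + i))
    q = X ÷ 2 ^ suc j
    1≤q : 1 ≤ q
    1≤q = *≤⇒≤÷ 1≤2^ (≤-trans (≤-reflexive (*-identityʳ (2 ^ suc j))) h)
    X<[1+q] : X < 2 ^ suc j * suc q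
    X<[1+q] = ≰⇒> λ le → <⇒≱ (n<1+n q) (*≤⇒≤÷ 1≤2^ le)
    rearrange : ∀ a q → 2 * a * (q + q) ≡ 4 * ((a + 0) * q)
    rearrange = solve-∀
    block : X ≤ 4 * upper
    block = begin
      X                                            ≤⟨ <⇒≤ X<[1+q] ⟩
      2 ^ suc j * suc q                            ≤⟨ *-monoʳ-≤ (2 ^ suc j) (+-monoˡ-≤ q 1≤q) ⟩
      2 ^ suc j * (q + q)                          ≡⟨ rearrange (2 ^ j) q ⟩
      4 * ((2 ^ j + 0) * q)                        ≡⟨ cong (4 *_) (Σ₁-const (2 ^ j + 0) q) ⟨
      4 * Σ₁ (2 ^ j + 0) (λ _ → q)                 ≤⟨ *-monoʳ-≤ 4 (Σ₁-mono (2 ^ j + 0) λ i 1≤i i≤ →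
                                                        ÷-antitone {X} (≤-trans 1≤i (m≤n+m i (2 ^ j))) (+-monoʳ-≤ (2 ^ j) i≤)) ⟩
      4 * upper                                    ∎

  weight1 : ∀ X y → weight 1 X y ≡ Σ₁ y (X ÷_)
  weight1 X y = Σ₁-cong y λ m _ _ → trans (cong (_* (X ÷ m)) (χ1 m)) (*-identityˡ _)

  ≤16*[/8] : ∀ {ℓ} → 8 ≤ ℓ → ℓ ≤ 16 * (ℓ / 8)
  ≤16*[/8] {ℓ} 8≤ℓ = begin
    ℓ                        ≡⟨ m≡m%n+[m/n]*n ℓ 8 ⟩
    ℓ % 8 + ℓ / 8 * 8        ≤⟨ +-monoˡ-≤ (ℓ / 8 * 8) (<⇒≤ (m%n<n ℓ 8)) ⟩
    1 * 8 + ℓ / 8 * 8        ≤⟨ +-monoˡ-≤ (ℓ / 8 * 8) (*-monoˡ-≤ 8 (m≥n⇒m/n>0 8≤ℓ)) ⟩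
    ℓ / 8 * 8 + ℓ / 8 * 8    ≡⟨ rearrange (ℓ / 8) ⟩
    16 * (ℓ / 8)             ∎
    where
    open ≤-Reasoning
    rearrange : ∀ a → a * 8 + a * 8 ≡ 16 * a
    rearrange = solve-∀

  8≤4^ : ∀ h → 8 ≤ 4 ^ (2 + h)
  8≤4^ h = ≤-trans (m≤m+n 8 8) (^-monoʳ-≤ 4 (m≤m+n 2 h))

  count-≥-ℓ/log : ∀ {n ℓ t s} → 1 ≤ n → ℓ ≤ n → n ≤ 2 ^ t → ℓ ≤ 2 ^ s → 8 * t ≤ ℓ → 4 ^ 9 ≤ ℓ →
                  ℓ ≤ 16 * (s * Σ₁ ℓ (χ n))
  count-≥-ℓ/log {n} {ℓ} {t} {s} 1≤n ℓ≤n n≤2^t ℓ≤2^s 8t≤ℓ 4^9≤ℓ = begin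
    ℓ                         ≤⟨ ≤16*[/8] (≤-trans (8≤4^ 7) 4^9≤ℓ) ⟩
    16 * (ℓ / 8)              ≡⟨ cong (16 *_) weight-single ⟨
    16 * weight n (ℓ / 8) 1   ≤⟨ *-monoʳ-≤ 16 (weight≤count {t = t} {s = s} 1≤n ℓ≤n n≤2^t ℓ≤2^s 1≤ℓ 8t≤ℓ 4^9≤ℓ (≤-reflexive (*-identityˡ ℓ))) ⟩
    16 * (s * Σ₁ ℓ (χ n))     ∎
    where
    open ≤-Reasoning
    1≤ℓ : 1 ≤ ℓ
    1≤ℓ = ≤-trans (m^n>0 4 9) 4^9≤ℓ
    weight-single : weight n (ℓ / 8) 1 ≡ ℓ / 8
    weight-single = trans (cong₂ _*_ (χ-yes n 1 (Coprime.1-coprimeTo n)) (n/1≡n (ℓ / 8))) (*-identityˡ _)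

  -- With 4^j ≤ ℓ < 4^(j+1) and y = 2^j, the harmonic sum gains a factor j, while bounding k by
  -- 2^(2(j+1)) loses 2 (j + 1) ≤ 4 j, so j cancels. The constant is 256 = 16 · 4 · 4: from rounding
  -- ℓ/8, from `harmonic`, and from this last loss.
  count-≥-density : ∀ {n ℓ t} → 1 ≤ n → ℓ ≤ n → n ≤ 2 ^ t → 256 * (t * t) ≤ ℓ → 4 ^ 18 ≤ ℓ →
                    Σ₁ n (χ n) * ℓ ≤ 256 * (n * Σ₁ ℓ (χ n))
  count-≥-density {n} {ℓ} {t} 1≤n ℓ≤n n≤2^t 256t²≤ℓ 4^18≤ℓ = *-cancelˡ-≤ j {{>-nonZero 1≤j}} (begin
    j * (Φ * ℓ)                       ≤⟨ *-monoʳ-≤ j (*-monoʳ-≤ Φ (≤16*[/8] (≤-trans (8≤4^ 16) 4^18≤ℓ))) ⟩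
    j * (Φ * (16 * X))                ≡⟨ rearrange₁ j Φ X ⟩
    16 * (Φ * (j * X))                ≤⟨ *-monoʳ-≤ 16 (*-monoʳ-≤ Φ (harmonic X j 2^j≤X)) ⟩
    16 * (Φ * (4 * Σ₁ (2 ^ j) (X ÷_)))  ≡⟨ cong (λ w → 16 * (Φ * (4 * w))) (weight1 X (2 ^ j)) ⟨
    16 * (Φ * (4 * weight 1 X (2 ^ j)))  ≡⟨ rearrange₂ Φ (weight 1 X (2 ^ j)) ⟩
    64 * (Φ * weight 1 X (2 ^ j))     ≤⟨ *-monoʳ-≤ 64 (density n 1≤n X (2 ^ j)) ⟩
    64 * (n * weight n X (2 ^ j))     ≤⟨ *-monoʳ-≤ 64 (*-monoʳ-≤ n (weight≤count {t = t} {s = 2 * suc j} {Z = 2 ^ j} 1≤n ℓ≤n n≤2^t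
                                           (≤-trans (<⇒≤ ℓ<4^) (≤-reflexive (^-*-assoc 2 2 (suc j))))
                                           (≤-trans (m≤m*n (2 ^ j) (2 ^ j)) 4^j≤′) 8t≤ 4^9≤ 4^j≤′)) ⟩
    64 * (n * (2 * suc j * c))        ≤⟨ *-monoʳ-≤ 64 (*-monoʳ-≤ n (*-monoˡ-≤ c (*-monoʳ-≤ 2 (+-monoˡ-≤ j 1≤j)))) ⟩
    64 * (n * (2 * (j + j) * c))      ≡⟨ rearrange₃ n j c ⟩
    j * (256 * (n * c))               ∎)
    where
    open ≤-Reasoning
    bracket = log-bracket 4 (s≤s (s≤s z≤n)) ℓ (≤-trans (m^n>0 4 18) 4^18≤ℓ)
    j X Φ c : ℕ
    j = proj₁ bracket
    X = ℓ / 8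
    Φ = Σ₁ n (χ n)
    c = Σ₁ ℓ (χ n)
    instance
      2^≢0 : NonZero (2 ^ j)
      2^≢0 = m^n≢0 2 j
    ℓ<4^ : ℓ < 4 ^ suc j
    ℓ<4^ = proj₂ (proj₂ bracket)
    4^j≤′ : 2 ^ j * 2 ^ j ≤ ℓ
    4^j≤′ = ≤-trans (≤-reflexive (sym (^-distribʳ-* j 2 2))) (proj₁ (proj₂ bracket))
    18≤j : 18 ≤ j
    18≤j = log-bracket-≥ 4 (s≤s (s≤s z≤n)) 4^18≤ℓ ℓ<4^
    1≤j : 1 ≤ j
    1≤j = ≤-trans (s≤s z≤n) 18≤j
    4^9≤ : 4 ^ 9 ≤ 2 ^ j
    4^9≤ = ≤-trans (≤-reflexive (^-*-assoc 2 2 9)) (^-monoʳ-≤ 2 18≤j)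
    2^j≤X : 2 ^ j ≤ X
    2^j≤X = *≤⇒≤÷ {ℓ} {8} (s≤s z≤n) (≤-trans (*-monoˡ-≤ (2 ^ j) (≤-trans (8≤4^ 7) 4^9≤)) 4^j≤′)
    square : ∀ a → 16 * a * (16 * a) ≡ 256 * (a * a)
    square = solve-∀
    double : ∀ a → 2 * (8 * a) ≡ 16 * a
    double = solve-∀
    -- In terms of square roots, 2^(j+1) > √ℓ ≥ 16 t; the argument compares squares instead.
    8t≤ : 8 * t ≤ 2 ^ j
    8t≤ = *-cancelˡ-≤ 2 (≮⇒≥ λ lt → <⇒≱ ℓ<4^ (begin
      4 ^ suc j                  ≡⟨ ^-distribʳ-* (suc j) 2 2 ⟩
      2 ^ suc j * 2 ^ suc j      ≤⟨ *-mono-≤ (<⇒≤ lt) (<⇒≤ lt) ⟩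
      2 * (8 * t) * (2 * (8 * t)) ≡⟨ cong₂ _*_ (double t) (double t) ⟩
      16 * t * (16 * t)          ≡⟨ square t ⟩
      256 * (t * t)              ≤⟨ 256t²≤ℓ ⟩
      ℓ                          ∎))
    rearrange₁ : ∀ j p x → j * (p * (16 * x)) ≡ 16 * (p * (j * x))
    rearrange₁ = solve-∀
    rearrange₂ : ∀ p w → 16 * (p * (4 * w)) ≡ 64 * (p * w)
    rearrange₂ = solve-∀
    rearrange₃ : ∀ n j c → 64 * (n * (2 * (j + j) * c)) ≡ j * (256 * (n * c))
    rearrange₃ = solve-∀

  -- Totients as sums of indicators

  module _ {p q} {P : Pred ℕ p} {Q : Pred ℕ q} (P? : Decidable P) (Q? : Decidable Q) where

    -- General in f because the induction on m replaces f by `f ∘ suc`. The `pred` reconciles lists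
    -- that start at 0 with sums that start at 1.
    length-filter-filter : ∀ f m → length (filter P? (filter Q? (applyUpTo f m))) ≡
                                   Σ₁ m (λ k → ⟦ P? (f (pred k)) ⟧ * ⟦ Q? (f (pred k)) ⟧)
    length-filter-filter f zero    = refl
    length-filter-filter f (suc m) = trans unfold (trans
      (cong (⟦ P? (f 0) ⟧ * ⟦ Q? (f 0) ⟧ +_) (trans (length-filter-filter (f ∘ suc) m)
        (Σ₁-cong m λ { (suc k) _ _ → refl })))
      (sym (Σ₁-++ 1 m (λ k → ⟦ P? (f (pred k)) ⟧ * ⟦ Q? (f (pred k)) ⟧))))
      where
      unfold : length (filter P? (filter Q? (applyUpTo f (suc m)))) ≡
               ⟦ P? (f 0) ⟧ * ⟦ Q? (f 0) ⟧ + length (filter P? (filter Q? (applyUpTo (f ∘ suc) m)))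
      unfold with Q? (f 0)
      ... | no _ = cong (_+ length (filter P? (filter Q? (applyUpTo (f ∘ suc) m)))) (sym (*-zeroʳ ⟦ P? (f 0) ⟧))
      ... | yes _ with P? (f 0)
      ...   | yes _ = refl
      ...   | no  _ = refl

  length-filter : ∀ {q} {Q : Pred ℕ q} (Q? : Decidable Q) f m →
                  length (filter Q? (applyUpTo f m)) ≡ Σ₁ m (λ k → ⟦ Q? (f (pred k)) ⟧)
  length-filter Q? f zero    = refl
  length-filter Q? f (suc m) = trans unfold (trans
    (cong (⟦ Q? (f 0) ⟧ +_) (trans (length-filter Q? (f ∘ suc) m) (Σ₁-cong m λ { (suc k) _ _ → refl })))
    (sym (Σ₁-++ 1 m (λ k → ⟦ Q? (f (pred k)) ⟧))))
    where
    unfold : length (filter Q? (applyUpTo f (suc m))) ≡ ⟦ Q? (f 0) ⟧ + length (filter Q? (applyUpTo (f ∘ suc) m))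
    unfold with Q? (f 0)
    ... | no  _ = refl
    ... | yes _ = refl

  Σ₁-pred : ∀ n f → Σ₁ n (λ k → f (pred k)) + f n ≡ Σ₁ n f + f 0
  Σ₁-pred zero    f = refl
  Σ₁-pred (suc n) f = trans (cong (_+ f (suc n)) (Σ₁-pred n f)) (rearrange (Σ₁ n f) (f 0) (f (suc n)))
    where
    rearrange : ∀ a b c → a + b + c ≡ a + c + b
    rearrange = solve-∀

  χ-self : ∀ n → χ n n ≡ χ n 0
  χ-self n = trans (cong (χ n) (sym (+-identityʳ n))) (χ-periodic n 0)

  -- 0 and n have the same gcd with n, so trading the residue 0 for n keeps the count; this includes
  -- n = 1, whose only residue is 0.
  φ≡Σ₁ : ∀ n → φ n ≡ Σ₁ n (χ n)
  φ≡Σ₁ n = trans (length-filter (λ x → gcd x n ≟ 1) id n)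
    (+-cancelʳ-≡ (χ n n) (Σ₁ n (λ k → χ n (pred k))) (Σ₁ n (χ n))
      (trans (Σ₁-pred n (χ n)) (cong (Σ₁ n (χ n) +_) (sym (χ-self n)))))

  Σ₁≤φ[] : ∀ {n ℓ} → 2 ≤ n → ℓ ≤ n → Σ₁ ℓ (χ n) ≤ φ[ n , ℓ ]
  Σ₁≤φ[] {n} {ℓ} 2≤n ℓ≤n = begin
    Σ₁ ℓ (χ n)
      ≡⟨ Σ₁-cong ℓ (λ k _ k≤ℓ → trans (cong (_* χ n k) (⟦⟧-yes (k ≤? ℓ) k≤ℓ)) (*-identityˡ _)) ⟨
    Σ₁ ℓ f
      ≤⟨ m≤m+n (Σ₁ ℓ f) _ ⟩
    Σ₁ ℓ f + Σ₁ (n ∸ ℓ) (λ i → f (ℓ + i))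
      ≡⟨ Σ₁-++ ℓ (n ∸ ℓ) f ⟨
    Σ₁ (ℓ + (n ∸ ℓ)) f
      ≡⟨ cong (λ n → Σ₁ n f) (m+[n∸m]≡n ℓ≤n) ⟩
    Σ₁ n f
      ≤⟨ m≤m+n (Σ₁ n f) (f 0) ⟩
    Σ₁ n f + f 0
      ≡⟨ Σ₁-pred n f ⟨
    Σ₁ n (λ k → f (pred k)) + f n
      ≡⟨ cong (Σ₁ n (λ k → f (pred k)) +_) (trans (cong (⟦ n ≤? ℓ ⟧ *_) χnn≡0) (*-zeroʳ ⟦ n ≤? ℓ ⟧)) ⟩
    Σ₁ n (λ k → f (pred k)) + 0
      ≡⟨ +-identityʳ _ ⟩
    Σ₁ n (λ k → f (pred k))
      ≡⟨ length-filter-filter (λ x → x ≤? ℓ) (λ x → gcd x n ≟ 1) id n ⟨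
    φ[ n , ℓ ] ∎
    where
    open ≤-Reasoning
    f : ℕ → ℕ
    f k = ⟦ k ≤? ℓ ⟧ * χ n k
    -- The index k = n, which the left side includes when ℓ = n, is not an element of `ℤ* n`; it
    -- counts for nothing because n ≥ 2.
    χnn≡0 : χ n n ≡ 0
    χnn≡0 = χ-no n n λ c → <⇒≢ 2≤n (sym (c (∣-refl , ∣-refl)))

open CoprimeCounting

open import Data.Integer.Base using (+_)
import Data.Integer.Base as ℤ
import Data.Integer.Properties as ℤ
open import Data.Nat.Base as ℕ using (zero; suc)
import Data.Nat.Properties as ℕ
open import Data.Rational.Base using (_/_)
open import Data.Rational.Base as ℚ using (ℚ; 0ℚ; 1ℚ; ½)
import Data.Rational.Properties as ℚ
open import Data.Rational.Solver using (module +-*-Solver)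
import Data.Rational.Unnormalised.Base as ℚᵘ
import Data.Rational.Unnormalised.Properties as ℚᵘ
open import Defs using (seq; Σ<; Σ<-+; Σ<-mono; Σ<-const; 1/-scale; 1/-anti; 0<1/; riemannSum; *-pos)

-- From counts in ℕ to inequalities between rational approximants

ι : ℕ → ℚ
ι n = + n / 1

toℚᵘ-/ : ∀ m n → ℚ.toℚᵘ (+ m / suc n) ℚᵘ.≃ ℚᵘ.mkℚᵘ (+ m) n
toℚᵘ-/ m n = ℚ.toℚᵘ-fromℚᵘ (ℚᵘ.mkℚᵘ (+ m) n)

ι-* : ∀ m n → ι m ℚ.* ι n ≡ ι (m ℕ.* n)
ι-* m n = ℚ.toℚᵘ-injective (ℚᵘ.≃-trans (ℚ.toℚᵘ-homo-* (ι m) (ι n))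
  (ℚᵘ.≃-trans (ℚᵘ.*-cong (toℚᵘ-/ m 0) (toℚᵘ-/ n 0))
  (ℚᵘ.≃-trans (ℚᵘ.*≡* (cong (ℤ._* + 1) (sym (ℤ.pos-* m n)))) (ℚᵘ.≃-sym (toℚᵘ-/ (m ℕ.* n) 0)))))

ι-mono : ∀ {m n} → m ≤ n → ι m ℚ.≤ ι n
ι-mono {m} {n} m≤n = ℚ.toℚᵘ-cancel-≤ (ℚᵘ.≤-respˡ-≃ (ℚᵘ.≃-sym (toℚᵘ-/ m 0))
  (ℚᵘ.≤-respʳ-≃ (ℚᵘ.≃-sym (toℚᵘ-/ n 0)) (ℚᵘ.*≤* (ℤ.*-monoʳ-≤-nonNeg (+ 1) (ℤ.+≤+ m≤n)))))

ι-cancel-≤ : ∀ m n → ι m ℚ.≤ ι n → m ≤ n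
ι-cancel-≤ m n h with ℚᵘ.≤-respˡ-≃ (toℚᵘ-/ m 0) (ℚᵘ.≤-respʳ-≃ (toℚᵘ-/ n 0) (ℚ.toℚᵘ-mono-≤ h))
... | ℚᵘ.*≤* le = ℤ.drop‿+≤+ (ℤ.*-cancelʳ-≤-pos (+ m) (+ n) (+ 1) le)

0≤ι : ∀ n → 0ℚ ℚ.≤ ι n
0≤ι n = ι-mono {0} {n} ℕ.z≤n

0<ι : ∀ {n} → 1 ≤ n → 0ℚ ℚ.< ι n
0<ι {n} 1≤n = ℚ.<-≤-trans (ℚ.positive⁻¹ 1ℚ) (ι-mono 1≤n)

ι-/ : ∀ ℓ n .{{_ : NonZero n}} → ι n ℚ.* (+ ℓ / n) ≡ ι ℓ
ι-/ ℓ (suc n) = ℚ.toℚᵘ-injective (ℚᵘ.≃-trans (ℚ.toℚᵘ-homo-* (ι (suc n)) (+ ℓ / suc n))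
  (ℚᵘ.≃-trans (ℚᵘ.*-cong (toℚᵘ-/ (suc n) 0) (toℚᵘ-/ ℓ n))
  (ℚᵘ.≃-trans (ℚᵘ.*≡* eq) (ℚᵘ.≃-sym (toℚᵘ-/ ℓ 0)))))
  where
  eq : (+ suc n ℤ.* + ℓ) ℤ.* + 1 ≡ + ℓ ℤ.* + (1 ℕ.* suc n)
  eq = trans (ℤ.*-identityʳ _) (trans (ℤ.*-comm (+ suc n) (+ ℓ))
    (cong (λ k → + ℓ ℤ.* + k) (sym (ℕ.*-identityˡ (suc n)))))

*-mono-≤-nonNeg : ∀ {a b c d} → 0ℚ ℚ.≤ a → a ℚ.≤ b → 0ℚ ℚ.≤ c → c ℚ.≤ d → a ℚ.* c ℚ.≤ b ℚ.* d
*-mono-≤-nonNeg {a} {b} {c} {d} 0≤a a≤b 0≤c c≤d = ℚ.≤-trans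
  (ℚ.*-monoʳ-≤-nonNeg c {{ℚ.nonNegative 0≤c}} a≤b)
  (ℚ.*-monoˡ-≤-nonNeg b {{ℚ.nonNegative (ℚ.≤-trans 0≤a a≤b)}} c≤d)

-- Each dyadic block of the Riemann sum contributes at least ½.
module _ (k : ℕ) where

  private
    N : ℕ
    N = suc k

    f : ℕ → ℚ
    f i = + 1 / (N ℕ.+ suc i)

    0≤Σ< : ∀ m g → (∀ i → 0ℚ ℚ.≤ g i) → 0ℚ ℚ.≤ Σ< m g
    0≤Σ< zero    g h = ℚ.≤-refl
    0≤Σ< (suc m) g h = ℚ.+-mono-≤ (0≤Σ< m g h) (h m)

    Σ<-extend : ∀ {m n} → m ≤ n → Σ< m f ℚ.≤ Σ< n f
    Σ<-extend {m} {n} m≤n = begin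
      Σ< m f                                              ≡⟨ ℚ.+-identityʳ _ ⟨
      Σ< m f ℚ.+ 0ℚ                                       ≤⟨ ℚ.+-monoʳ-≤ (Σ< m f) (0≤Σ< (n ℕ.∸ m) _ λ i → ℚ.<⇒≤ (0<1/ (k ℕ.+ suc (m ℕ.+ i)))) ⟩
      Σ< m f ℚ.+ Σ< (n ℕ.∸ m) (λ i → f (m ℕ.+ i))         ≡⟨ Σ<-+ m (n ℕ.∸ m) f ⟨
      Σ< (m ℕ.+ (n ℕ.∸ m)) f                              ≡⟨ cong (λ n → Σ< n f) (ℕ.m+[n∸m]≡n m≤n) ⟩
      Σ< n f                                              ∎
      where open ℚ.≤-Reasoning

    block : ∀ e → ½ ℚ.≤ Σ< (suc e ℕ.* N) (λ j → f (e ℕ.* N ℕ.+ j))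
    block e = subst (ℚ._≤ Σ< L (λ j → f (e ℕ.* N ℕ.+ j)))
      (trans (Σ<-const L (+ 1 / (2 ℕ.* L))) (1/-scale 1 (k ℕ.+ e ℕ.* N)))
      (Σ<-mono L λ j j<L → 1/-anti (begin
        N ℕ.+ suc (e ℕ.* N ℕ.+ j)    ≡⟨ rearrange N (e ℕ.* N) j ⟩
        L ℕ.+ suc j                  ≤⟨ ℕ.+-monoʳ-≤ L j<L ⟩
        L ℕ.+ L                      ≡⟨ cong (L ℕ.+_) (ℕ.+-identityʳ L) ⟨
        2 ℕ.* L                      ∎))
      where
      open ℕ.≤-Reasoning
      L : ℕ
      L = suc e ℕ.* N
      rearrange : ∀ a b c → a ℕ.+ suc (b ℕ.+ c) ≡ a ℕ.+ b ℕ.+ suc c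
      rearrange = solve-∀

    dyadic : ∀ t → ι t ℚ.* ½ ℚ.≤ Σ< ((2 ℕ.^ t ℕ.∸ 1) ℕ.* N) f
    dyadic zero    = ℚ.≤-refl
    dyadic (suc t) = begin
      ι (suc t) ℚ.* ½                                     ≡⟨ Σ<-const (suc t) ½ ⟨
      Σ< t (λ _ → ½) ℚ.+ ½                                ≡⟨ cong (ℚ._+ ½) (Σ<-const t ½) ⟩
      ι t ℚ.* ½ ℚ.+ ½                                     ≤⟨ ℚ.+-mono-≤ (dyadic t) (block e) ⟩
      Σ< (e ℕ.* N) f ℚ.+ Σ< (suc e ℕ.* N) (λ j → f (e ℕ.* N ℕ.+ j))
                                                          ≡⟨ Σ<-+ (e ℕ.* N) (suc e ℕ.* N) f ⟨
      Σ< (e ℕ.* N ℕ.+ suc e ℕ.* N) f                      ≡⟨ cong (λ m → Σ< m f) length ⟩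
      Σ< ((2 ℕ.^ suc t ℕ.∸ 1) ℕ.* N) f                    ∎
      where
      open ℚ.≤-Reasoning
      e : ℕ
      e = 2 ℕ.^ t ℕ.∸ 1
      suc-e : suc e ≡ 2 ℕ.^ t
      suc-e = ℕ.m+[n∸m]≡n (ℕ.m^n>0 2 t)
      length : e ℕ.* N ℕ.+ suc e ℕ.* N ≡ (2 ℕ.^ suc t ℕ.∸ 1) ℕ.* N
      length = trans (sym (ℕ.*-distribʳ-+ N e (suc e))) (cong (ℕ._* N)
        (trans (cong (e ℕ.+_) (sym (ℕ.+-identityʳ (suc e)))) (cong (λ m → m ℕ.+ (m ℕ.+ 0) ℕ.∸ 1) suc-e)))

  -- Holds for every mesh k and not just in the limit, so a strict inequality between reals can be
  -- exploited at a single index.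
  riemannSum-≥ : ∀ {t n} → 2 ℕ.^ t ≤ n → ι t ℚ.* ½ ℚ.≤ riemannSum n k
  riemannSum-≥ {t} {n} h = ℚ.≤-trans (dyadic t) (Σ<-extend (ℕ.*-monoˡ-≤ N (ℕ.∸-monoˡ-≤ 1 h)))

-- The exponent 18 guarantees √ℓ ≥ 4 ^ 9, the threshold in expψ-large, for ℓ ≥ C.
abstract
  C : ℕ
  C = 4 ℕ.^ 18

  C≡ : C ≡ 4 ℕ.^ 18
  C≡ = refl

4^≤C : ∀ {h} → h ≤ 18 → 4 ℕ.^ h ≤ C
4^≤C h≤18 = ℕ.≤-trans (ℕ.^-monoʳ-≤ 4 h≤18) (ℕ.≤-reflexive (sym C≡))

1≤C : 1 ≤ C
1≤C = 4^≤C ℕ.z≤n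

-- The constant of `count-≥-density`; the estimates for part (ii) yield the larger 1/64.
κ : ℚ
κ = + 1 / 256

module _ {n t : ℕ} (2^t≤n : 2 ℕ.^ t ≤ n) (k : ℕ) where

  private
    L : ℚ
    L = riemannSum n k ℚ.⊔ 1ℚ

  1≤log : 1ℚ ℚ.≤ L
  1≤log = ℚ.p≤q⊔p (riemannSum n k) 1ℚ

  log-≥ : ι t ℚ.* ½ ℚ.≤ L
  log-≥ = ℚ.≤-trans (riemannSum-≥ k {t} 2^t≤n) (ℚ.p≤p⊔q (riemannSum n k) 1ℚ)

  private
    0≤½t : 0ℚ ℚ.≤ ι t ℚ.* ½
    0≤½t = *-mono-≤-nonNeg {0ℚ} {ι t} {0ℚ} {½} ℚ.≤-refl (0≤ι t) ℚ.≤-refl (ℚ.nonNegative⁻¹ ½)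

    0≤1 : 0ℚ ℚ.≤ 1ℚ
    0≤1 = ℚ.nonNegative⁻¹ 1ℚ

    scale : ∀ {a u} → 0ℚ ℚ.≤ a → a ℚ.≤ u → a ℚ.≤ L ℚ.* u
    scale {a} {u} 0≤a a≤u = ℚ.≤-trans (ℚ.≤-reflexive (sym (ℚ.*-identityˡ a))) (*-mono-≤-nonNeg 0≤1 1≤log 0≤a a≤u)

  module _ {ℓ : ℕ} {ε : ℚ} (0<ε : 0ℚ ℚ.< ε) where

    private
      drop : ∀ {a} → a ℚ.+ ε ℚ.≤ ι ℓ → a ℚ.≤ ι ℓ
      drop {a} h = ℚ.≤-trans (ℚ.≤-trans (ℚ.≤-reflexive (sym (ℚ.+-identityʳ a))) (ℚ.+-monoʳ-≤ a (ℚ.<⇒≤ 0<ε))) h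

      lower : ∀ {a b} → 0ℚ ℚ.≤ a → a ℚ.≤ b → ι C ℚ.* b ℚ.+ ε ℚ.≤ ι ℓ → ι C ℚ.* a ℚ.≤ ι ℓ
      lower {a} {b} 0≤a a≤b h = ℚ.≤-trans (*-mono-≤-nonNeg {ι C} {ι C} (0≤ι C) ℚ.≤-refl 0≤a a≤b) (drop h)

      C≤ : ι C ℚ.* 1ℚ ℚ.≤ ι ℓ → C ≤ ℓ
      C≤ h = ι-cancel-≤ C ℓ (ℚ.≤-trans (ℚ.≤-reflexive (sym (ℚ.*-identityʳ (ι C)))) h)

    -- The maximum with 1 in the logarithm gives the first bound, and ln n ≥ t/2 the second.
    linear-bounds : ι C ℚ.* L ℚ.+ ε ℚ.≤ ι ℓ → C ≤ ℓ × C ℕ.* t ≤ 2 ℕ.* ℓ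
    linear-bounds h = C≤ (lower 0≤1 1≤log h) , ι-cancel-≤ (C ℕ.* t) (2 ℕ.* ℓ) (begin
      ι (C ℕ.* t)                      ≡⟨ ι-* C t ⟨
      ι C ℚ.* ι t                      ≡⟨ solve 2 (λ c t → c :* t := con (ι 2) :* (c :* (t :* con ½))) refl (ι C) (ι t) ⟩
      ι 2 ℚ.* (ι C ℚ.* (ι t ℚ.* ½))    ≤⟨ ℚ.*-monoˡ-≤-nonNeg (ι 2) (lower 0≤½t log-≥ h) ⟩
      ι 2 ℚ.* ι ℓ                      ≡⟨ ι-* 2 ℓ ⟩
      ι (2 ℕ.* ℓ)                      ∎)
      where
      open ℚ.≤-Reasoning
      open +-*-Solver

    -- The nested product is the k-th term of `log n ^ᴿ 5`. One factor is bounded below by t/2 and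
    -- the remaining fourth power by t/2 as well, since L ≥ 1; this yields the square of t that
    -- `count-≥-density` asks for.
    quintic-bounds : ι C ℚ.* (L ℚ.* (L ℚ.* (L ℚ.* (L ℚ.* (L ℚ.* 1ℚ))))) ℚ.+ ε ℚ.≤ ι ℓ →
                     C ≤ ℓ × C ℕ.* (t ℕ.* t) ≤ 4 ℕ.* ℓ
    quintic-bounds h = C≤ (lower 0≤1 (scale 0≤1 (scale 0≤1 (scale 0≤1 (scale 0≤1 (scale 0≤1 ℚ.≤-refl))))) h) ,
      ι-cancel-≤ (C ℕ.* (t ℕ.* t)) (4 ℕ.* ℓ) (begin
        ι (C ℕ.* (t ℕ.* t))                        ≡⟨ trans (cong (ι C ℚ.*_) (ι-* t t)) (ι-* C (t ℕ.* t)) ⟨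
        ι C ℚ.* (ι t ℚ.* ι t)
          ≡⟨ solve 2 (λ c t → c :* (t :* t) := con (ι 4) :* (c :* ((t :* con ½) :* (t :* con ½)))) refl (ι C) (ι t) ⟩
        ι 4 ℚ.* (ι C ℚ.* (ι t ℚ.* ½ ℚ.* (ι t ℚ.* ½)))
          ≤⟨ ℚ.*-monoˡ-≤-nonNeg (ι 4) (lower 0≤sq sq≤ h) ⟩
        ι 4 ℚ.* ι ℓ                                ≡⟨ ι-* 4 ℓ ⟩
        ι (4 ℕ.* ℓ)                                ∎)
      where
      open ℚ.≤-Reasoning
      open +-*-Solver
      L^4≥ : ι t ℚ.* ½ ℚ.≤ L ℚ.* (L ℚ.* (L ℚ.* (L ℚ.* 1ℚ)))
      L^4≥ = scale 0≤½t (scale 0≤½t (scale 0≤½t (ℚ.≤-trans log-≥ (ℚ.≤-reflexive (sym (ℚ.*-identityʳ L))))))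
      0≤sq : 0ℚ ℚ.≤ ι t ℚ.* ½ ℚ.* (ι t ℚ.* ½)
      0≤sq = *-mono-≤-nonNeg {0ℚ} {_} {0ℚ} ℚ.≤-refl 0≤½t ℚ.≤-refl 0≤½t
      sq≤ : ι t ℚ.* ½ ℚ.* (ι t ℚ.* ½) ℚ.≤ L ℚ.* (L ℚ.* (L ℚ.* (L ℚ.* (L ℚ.* 1ℚ))))
      sq≤ = *-mono-≤-nonNeg 0≤½t log-≥ 0≤½t L^4≥

≤⇒≤ᴿ : ∀ x y → (∀ k → seq x k ℚ.≤ seq y k) → x ≤ᴿ y
≤⇒≤ᴿ x y h ε 0<ε = 0 , λ k _ → ℚ.≤-trans (h k)
  (ℚ.≤-trans (ℚ.≤-reflexive (sym (ℚ.+-identityʳ (seq y k)))) (ℚ.+-monoʳ-≤ (seq y k) (ℚ.<⇒≤ 0<ε)))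

0<ℚ⇒0<ᴿ : ∀ {q} → 0ℚ ℚ.< q → 0ᴿ <ᴿ fromℚ q
0<ℚ⇒0<ᴿ {q} 0<q = q , 0<q , 0 , λ _ _ → ℚ.≤-reflexive (ℚ.+-identityˡ q)

-- The second maximum with 1 comes from `recip`, which bounds each term below by the witness of
-- positivity, and that witness is 1 in `0<log`.
recip-log : ∀ ℓ .{{_ : NonZero ℓ}} k →
  (riemannSum ℓ k ℚ.⊔ 1ℚ ℚ.⊔ 1ℚ) ℚ.* seq (recip (log ℓ) (0<log ℓ)) k ≡ 1ℚ
recip-log ℓ k = ℚ.*-inverseʳ (riemannSum ℓ k ℚ.⊔ 1ℚ ℚ.⊔ 1ℚ)
  {{ℚ.>-nonZero (ℚ.<-≤-trans (ℚ.positive⁻¹ 1ℚ) (ℚ.p≤q⊔p (riemannSum ℓ k ℚ.⊔ 1ℚ) 1ℚ))}}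

ι256*κ : ι 256 ℚ.* κ ≡ 1ℚ
ι256*κ = refl

ratio-bound : ∀ {n ℓ a b} .{{_ : NonZero n}} → a ℕ.* ℓ ≤ 256 ℕ.* (n ℕ.* b) → κ ℚ.* (+ ℓ / n) ℚ.* ι a ℚ.≤ ι b
ratio-bound {n} {ℓ} {a} {b} h = ℚ.*-cancelˡ-≤-pos (ι 256 ℚ.* ι n)
  {{ℚ.positive (*-pos (ℚ.positive⁻¹ (ι 256)) (0<ι (ℕ.>-nonZero⁻¹ n)))}} (begin
    ι 256 ℚ.* ι n ℚ.* (κ ℚ.* (+ ℓ / n) ℚ.* ι a)
      ≡⟨ solve 5 (λ d n k q a → d :* n :* (k :* q :* a) := (d :* k) :* (a :* (n :* q))) refl (ι 256) (ι n) κ (+ ℓ / n) (ι a) ⟩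
    (ι 256 ℚ.* κ) ℚ.* (ι a ℚ.* (ι n ℚ.* (+ ℓ / n)))
      ≡⟨ cong₂ ℚ._*_ ι256*κ (cong (ι a ℚ.*_) (ι-/ ℓ n)) ⟩
    1ℚ ℚ.* (ι a ℚ.* ι ℓ)
      ≡⟨ trans (ℚ.*-identityˡ _) (ι-* a ℓ) ⟩
    ι (a ℕ.* ℓ)
      ≤⟨ ι-mono h ⟩
    ι (256 ℕ.* (n ℕ.* b))
      ≡⟨ trans (cong (ℚ._* ι b) (ι-* 256 n)) (trans (ι-* (256 ℕ.* n) b) (cong ι (ℕ.*-assoc 256 n b))) ⟨
    ι 256 ℚ.* ι n ℚ.* ι b ∎)
  where
  open ℚ.≤-Reasoning
  open +-*-Solver

log-bound : ∀ {ℓ s b} .{{_ : NonZero ℓ}} → 2 ℕ.^ s ≤ ℓ → ℓ ≤ 32 ℕ.* (s ℕ.* b) → ∀ k →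
            κ ℚ.* (ι ℓ ℚ.* seq (recip (log ℓ) (0<log ℓ)) k) ℚ.≤ ι b
log-bound {ℓ} {s} {b} 2^s≤ℓ h k = ℚ.*-cancelˡ-≤-pos (ι 256 ℚ.* G)
  {{ℚ.positive (*-pos (ℚ.positive⁻¹ (ι 256)) (ℚ.<-≤-trans (ℚ.positive⁻¹ 1ℚ) (ℚ.p≤q⊔p L 1ℚ)))}} (begin
    ι 256 ℚ.* G ℚ.* (κ ℚ.* (ι ℓ ℚ.* r))
      ≡⟨ solve 5 (λ d g k l r → d :* g :* (k :* (l :* r)) := (d :* k) :* l :* (g :* r)) refl (ι 256) G κ (ι ℓ) r ⟩
    (ι 256 ℚ.* κ) ℚ.* ι ℓ ℚ.* (G ℚ.* r)
      ≡⟨ cong₂ (λ u v → u ℚ.* ι ℓ ℚ.* v) ι256*κ (recip-log ℓ k) ⟩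
    1ℚ ℚ.* ι ℓ ℚ.* 1ℚ
      ≡⟨ trans (ℚ.*-identityʳ _) (ℚ.*-identityˡ _) ⟩
    -- The constant 32 is relaxed to 128 = 256/2 to fit the common κ; the division by 2 matches log
    -- ℓ ≥ s/2 below.
    ι ℓ
      ≤⟨ ι-mono (ℕ.≤-trans h (ℕ.*-monoˡ-≤ (s ℕ.* b) (ℕ.m≤m+n 32 96))) ⟩
    ι (128 ℕ.* (s ℕ.* b))
      ≡⟨ trans (cong (ι 128 ℚ.*_) (ι-* s b)) (ι-* 128 (s ℕ.* b)) ⟨
    ι 128 ℚ.* (ι s ℚ.* ι b)
      ≡⟨ solve 2 (λ s b → con (ι 128) :* (s :* b) := con (ι 256) :* (s :* con ½) :* b) refl (ι s) (ι b) ⟩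
    ι 256 ℚ.* (ι s ℚ.* ½) ℚ.* ι b
      ≤⟨ ℚ.*-monoʳ-≤-nonNeg (ι b) {{ℚ.nonNegative (0≤ι b)}} (ℚ.*-monoˡ-≤-nonNeg (ι 256)
           (ℚ.≤-trans (log-≥ {ℓ} {s} 2^s≤ℓ k) (ℚ.p≤p⊔q L 1ℚ))) ⟩
    ι 256 ℚ.* G ℚ.* ι b ∎)
  where
  open ℚ.≤-Reasoning
  open +-*-Solver
  L G r : ℚ
  L = riemannSum ℓ k ℚ.⊔ 1ℚ
  G = L ℚ.⊔ 1ℚ
  r = seq (recip (log ℓ) (0<log ℓ)) k

-- The two parts of the theorem for given n and ℓ

1≤bracket : ∀ {s x} → 2 ≤ x → x ℕ.< 2 ℕ.^ suc s → 1 ≤ s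
1≤bracket 2≤x = log-bracket-≥ 2 ℕ.≤-refl 2≤x

suc≤double : ∀ {t} → 1 ≤ t → suc t ≤ 2 ℕ.* t
suc≤double {t} 1≤t = ℕ.≤-trans (ℕ.+-monoˡ-≤ t 1≤t) (ℕ.≤-reflexive (cong (t ℕ.+_) (sym (ℕ.+-identityʳ t))))

module _ {n ℓ : ℕ} (2≤n : 2 ≤ n) (ℓ≤n : ℓ ≤ n) where

  private
    1≤n : 1 ≤ n
    1≤n = ℕ.<⇒≤ 2≤n
    bracket = log-bracket 2 ℕ.≤-refl n 1≤n
    -- t = ⌊log₂ n⌋. The side 2^t ≤ n bounds log n from below by t/2, while n < 2^(t+1) supplies the
    -- counting lemmas with the exponent `suc t`; as n ≥ 2, the two differ by a factor of at most 2.
    t : ℕ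
    t = proj₁ bracket
    2^t≤n : 2 ℕ.^ t ≤ n
    2^t≤n = proj₁ (proj₂ bracket)
    n<2^ : n ℕ.< 2 ℕ.^ suc t
    n<2^ = proj₂ (proj₂ bracket)
    1≤t : 1 ≤ t
    1≤t = 1≤bracket {t} 2≤n n<2^

  part-i : .{{_ : NonZero n}} → fromℕ C *ᴿ log n ^ᴿ 5 <ᴿ fromℕ ℓ →
           fromℚ κ *ᴿ fromℚ (+ ℓ / n) *ᴿ fromℕ (φ n) ≤ᴿ fromℕ φ[ n , ℓ ]
  part-i (ε , 0<ε , k , h) = ≤⇒≤ᴿ (fromℚ κ *ᴿ fromℚ (+ ℓ / n) *ᴿ fromℕ (φ n)) (fromℕ φ[ n , ℓ ]) λ _ → ratio-bound {n} {ℓ} {φ n} {φ[ n , ℓ ]} (begin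
    φ n ℕ.* ℓ                          ≡⟨ cong (ℕ._* ℓ) (φ≡Σ₁ n) ⟩
    Σ₁ n (χ n) ℕ.* ℓ                   ≤⟨ count-≥-density {n} {ℓ} {suc t} 1≤n ℓ≤n (ℕ.<⇒≤ n<2^) T² (ℕ.≤-trans (4^≤C ℕ.≤-refl) C≤ℓ) ⟩
    256 ℕ.* (n ℕ.* Σ₁ ℓ (χ n))         ≤⟨ ℕ.*-monoʳ-≤ 256 (ℕ.*-monoʳ-≤ n (Σ₁≤φ[] 2≤n ℓ≤n)) ⟩
    256 ℕ.* (n ℕ.* φ[ n , ℓ ])         ∎)
    where
    open ℕ.≤-Reasoning
    bounds = quintic-bounds {n} {t} 2^t≤n k {ℓ} 0<ε (h k ℕ.≤-refl)
    C≤ℓ : C ≤ ℓ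
    C≤ℓ = proj₁ bounds
    rearrange : ∀ a → 4 ℕ.* (256 ℕ.* (2 ℕ.* a ℕ.* (2 ℕ.* a))) ≡ 4096 ℕ.* (a ℕ.* a)
    rearrange = solve-∀
    T² : 256 ℕ.* (suc t ℕ.* suc t) ≤ ℓ
    T² = ℕ.*-cancelˡ-≤ 4 (begin
      4 ℕ.* (256 ℕ.* (suc t ℕ.* suc t))              ≤⟨ ℕ.*-monoʳ-≤ 4 (ℕ.*-monoʳ-≤ 256 (ℕ.*-mono-≤ (suc≤double 1≤t) (suc≤double 1≤t))) ⟩
      4 ℕ.* (256 ℕ.* (2 ℕ.* t ℕ.* (2 ℕ.* t)))        ≡⟨ rearrange t ⟩
      4 ℕ.^ 6 ℕ.* (t ℕ.* t)                          ≤⟨ ℕ.*-monoˡ-≤ (t ℕ.* t) (4^≤C {6} (ℕ.m≤m+n 6 12)) ⟩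
      C ℕ.* (t ℕ.* t)                                ≤⟨ proj₂ bounds ⟩
      4 ℕ.* ℓ                                        ∎)

  part-ii : .{{_ : NonZero n}} .{{_ : NonZero ℓ}} → fromℕ C *ᴿ log n <ᴿ fromℕ ℓ →
            fromℚ κ *ᴿ (fromℕ ℓ *ᴿ recip (log ℓ) (0<log ℓ)) ≤ᴿ fromℕ φ[ n , ℓ ]
  part-ii (ε , 0<ε , k , h) = ≤⇒≤ᴿ (fromℚ κ *ᴿ (fromℕ ℓ *ᴿ recip (log ℓ) (0<log ℓ))) (fromℕ φ[ n , ℓ ]) (log-bound {ℓ} {s} {φ[ n , ℓ ]} 2^s≤ℓ (begin
    ℓ                                       ≤⟨ count-≥-ℓ/log {n} {ℓ} {suc t} {suc s} 1≤n ℓ≤n (ℕ.<⇒≤ n<2^) (ℕ.<⇒≤ ℓ<2^) 8T≤ℓ (ℕ.≤-trans (4^≤C (ℕ.m≤m+n 9 9)) C≤ℓ) ⟩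
    16 ℕ.* (suc s ℕ.* Σ₁ ℓ (χ n))           ≤⟨ ℕ.*-monoʳ-≤ 16 (ℕ.*-mono-≤ (suc≤double 1≤s) (Σ₁≤φ[] 2≤n ℓ≤n)) ⟩
    16 ℕ.* (2 ℕ.* s ℕ.* φ[ n , ℓ ])         ≡⟨ rearrange s φ[ n , ℓ ] ⟩
    32 ℕ.* (s ℕ.* φ[ n , ℓ ])               ∎))
    where
    open ℕ.≤-Reasoning
    bounds = linear-bounds {n} {t} 2^t≤n k {ℓ} 0<ε (h k ℕ.≤-refl)
    C≤ℓ : C ≤ ℓ
    C≤ℓ = proj₁ bounds
    ℓ-bracket = log-bracket 2 ℕ.≤-refl ℓ (ℕ.≤-trans 1≤C C≤ℓ)
    s : ℕ
    s = proj₁ ℓ-bracket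
    2^s≤ℓ : 2 ℕ.^ s ≤ ℓ
    2^s≤ℓ = proj₁ (proj₂ ℓ-bracket)
    ℓ<2^ : ℓ ℕ.< 2 ℕ.^ suc s
    ℓ<2^ = proj₂ (proj₂ ℓ-bracket)
    1≤s : 1 ≤ s
    1≤s = 1≤bracket {s} (ℕ.≤-trans (ℕ.≤-trans (ℕ.m≤m+n 2 2) (4^≤C {1} (ℕ.s≤s ℕ.z≤n))) C≤ℓ) ℓ<2^
    rearrange : ∀ a b → 16 ℕ.* (2 ℕ.* a ℕ.* b) ≡ 32 ℕ.* (a ℕ.* b)
    rearrange = solve-∀
    rearrange′ : ∀ a → 2 ℕ.* (8 ℕ.* (2 ℕ.* a)) ≡ 32 ℕ.* a
    rearrange′ = solve-∀
    8T≤ℓ : 8 ℕ.* suc t ≤ ℓ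
    8T≤ℓ = ℕ.*-cancelˡ-≤ 2 (begin
      2 ℕ.* (8 ℕ.* suc t)            ≤⟨ ℕ.*-monoʳ-≤ 2 (ℕ.*-monoʳ-≤ 8 (suc≤double 1≤t)) ⟩
      2 ℕ.* (8 ℕ.* (2 ℕ.* t))        ≡⟨ rearrange′ t ⟩
      32 ℕ.* t                       ≤⟨ ℕ.*-monoˡ-≤ t (ℕ.≤-trans (ℕ.m≤m+n 32 32) (4^≤C {3} (ℕ.m≤m+n 3 15))) ⟩
      C ℕ.* t                        ≤⟨ proj₂ bounds ⟩
      2 ℕ.* ℓ                        ∎)

mainTheorem3 : ∃ λ (c : ℝ) → ∃ λ (κ : ℝ) → 0ᴿ <ᴿ c × 0ᴿ <ᴿ κ ×
    (∀ (n ℓ : ℕ) .{{_ : NonZero n}} .{{_ : NonZero ℓ}} → 2 ≤ n → 1 ≤ ℓ → ℓ ≤ n →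
    (c *ᴿ log n ^ᴿ 5 <ᴿ fromℕ ℓ →
    κ *ᴿ fromℚ (+ ℓ / n) *ᴿ fromℕ (φ n) ≤ᴿ fromℕ φ[ n , ℓ ])
    ×
    (c *ᴿ log n <ᴿ fromℕ ℓ →
    κ *ᴿ (fromℕ ℓ *ᴿ recip (log ℓ) (0<log ℓ)) ≤ᴿ fromℕ φ[ n , ℓ ]))
mainTheorem3 = fromℕ C , fromℚ κ , 0<ℚ⇒0<ᴿ (0<ι 1≤C) , 0<ℚ⇒0<ᴿ (ℚ.positive⁻¹ κ) ,
  λ n ℓ 2≤n _ ℓ≤n → part-i 2≤n ℓ≤n , part-ii 2≤n ℓ≤n
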